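{- Let $B$ be a $d$-dimensional brick with $d\ge1$, let $Y\subseteq\mathbb{R}^\infty$ be a robust configuration, and let $F$ be a finite configuration. If $B\times Y$ contains a copy of $F$ and $Y$ does not contain a copy of $F$, then $F$ is P-Ramsey.
   Context: $\mathbb{R}^\infty$ denotes the subspace of $\ell^2$ of real sequences with only finitely many nonzero entries, with the Euclidean metric. A configuration is a set of points of $\mathbb{R}^\infty$. A copy of a configuration $B$ (a configuration congruent to $B$) is a configuration $B'$ for which there is a distance-preserving bijection $B\to B'$; a configuration $A$ contains a copy of $B$ if some subset of $A$ is a copy of $B$. A configuration is $X$-free if it contains no copy of $X$. For configurations $A,B$ and an integer $r\ge1$, $A\rightarrow(B)_r$ means that every coloring of the points of $A$ with $r$ colors admits a monochromatic subset of $A$ that is a copy of $B$. The product $A\times B$ of configurations is the Cartesian product with $\|(a,b)-(a',b')\|^2=\|a-a'\|^2+\|b-b'\|^2$, regarded as a configuration in $\mathbb{R}^\infty$ (up to isometry). A configuration $B$ is a $d$-dimensional brick if there exist positive real numbers $a_1,\ldots,a_d$ such that $B$ is congruent to $\{(x_1,\ldots,x_d): x_i=0\text{ or }x_i=a_i,\ 1\le i\le d\}$. A countable configuration $Y$ is robust if for every finite configuration $C$ such that $Y$ contains a copy of $C$, we have $Y\rightarrow(C)_r$ for every integer $r\ge1$. A finite configuration $X\subseteq\mathbb{R}^\infty$ is P-Ramsey if there exist a configuration $W\subseteq\mathbb{R}^\infty$ and a real number $\mu>0$ such that: (i) $W\rightarrow(X)_r$ for every integer $r\ge1$; (ii) every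 finite $W'\subseteq W$ contains a subset $Z\subseteq W'$ with $|Z|\ge\mu|W'|$ such that $Z$ is $X$-free. -}

module Defs where

open import Algebra.Bundles using (CommutativeRing)
open import Data.Fin.Base using (Fin; toℕ)
open import Data.Nat.Base as ℕ using (ℕ; zero; suc)
import Data.Nat.Properties as ℕₚ
open import Data.Product.Base using (Σ; ∃; _×_; _,_; proj₁; proj₂)
open import Data.Sum.Base as Sum using (_⊎_; inj₁; inj₂)
open import Function.Bundles using (Func; Injection; Bijection)
open import Level using (0ℓ)
open import Relation.Binary.Bundles using (Setoid)
open import Relation.Binary.Core using (Rel)
open import Relation.Binary.Definitions using (_Respects_)
open import Relation.Binary.PropositionalEquality.Core as ≡ using (_≡_)
open import Relation.Binary.PropositionalEquality.Properties as ≡ using (setoid)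
open import Relation.Binary.Structures using (IsTotalOrder)
open import Relation.Nullary.Negation.Core using (¬_)
open import Relation.Unary using (Pred; Satisfiable)

-- The real numbers enter through their classical axiomatisation, which
-- determines them up to unique isomorphism.  Under excluded middle for Set₁,
-- taking suprema only of Set-valued predicates loses no generality.
record CompleteOrderedField : Set₁ where
  infix 4 _≤_ _<_
  field
    commutativeRing : CommutativeRing 0ℓ 0ℓ

  open CommutativeRing commutativeRing public

  field
    0≉1          : ¬ (0# ≈ 1#)
    inverse      : ∀ x → ¬ (x ≈ 0#) → ∃ λ y → x * y ≈ 1#
    _≤_          : Rel Carrier 0ℓ
    isTotalOrder : IsTotalOrder _≈_ _≤_
    +-monoʳ-≤    : ∀ x {y z} → y ≤ z → x + y ≤ x + z
    *-nonneg     : ∀ {x y} → 0# ≤ x → 0# ≤ y → 0# ≤ x * y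

  _<_ : Rel Carrier 0ℓ
  x < y = x ≤ y × ¬ (x ≈ y)

  UpperBound : Pred Carrier 0ℓ → Pred Carrier 0ℓ
  UpperBound P u = ∀ x → P x → x ≤ u

  field
    supremum : (P : Pred Carrier 0ℓ) → Satisfiable P → Satisfiable (UpperBound P) →
               ∃ λ s → UpperBound P s × (∀ u → UpperBound P u → s ≤ u)

module Configurations (ℝ : CompleteOrderedField) where

  open CompleteOrderedField ℝ
  open IsTotalOrder isTotalOrder using (total)
    renaming (trans to ≤-trans; reflexive to ≤-reflexive; ≤-respˡ-≈ to ≤-respˡ; ≤-respʳ-≈ to ≤-respʳ)
  open import Algebra.Properties.Ring ring using (-‿distribˡ-*; -‿distribʳ-*; -‿involutive)
  open import Algebra.Properties.CommutativeMonoid.Sum +-commutativeMonoid using (sum-syntax)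
  open import Algebra.Properties.Monoid.Mult +-monoid using () renaming (_×_ to _×ℕ_)
  open import Relation.Binary.Reasoning.Setoid (CommutativeRing.setoid commutativeRing)

  private
    +-nonneg : ∀ {x y} → 0# ≤ x → 0# ≤ y → 0# ≤ x + y
    +-nonneg {x} 0≤x 0≤y = ≤-trans 0≤x (≤-respˡ (+-identityʳ x) (+-monoʳ-≤ x 0≤y))

    neg-nonneg : ∀ {x} → x ≤ 0# → 0# ≤ - x
    neg-nonneg {x} x≤0 =
      ≤-respˡ (-‿inverseˡ x) (≤-respʳ (+-identityʳ (- x)) (+-monoʳ-≤ (- x) x≤0))

    square-nonneg : ∀ x → 0# ≤ x * x
    square-nonneg x with total 0# x
    ... | inj₁ 0≤x = *-nonneg 0≤x 0≤x
    ... | inj₂ x≤0 = ≤-respʳ eq (*-nonneg (neg-nonneg x≤0) (neg-nonneg x≤0))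
      where
      eq : - x * - x ≈ x * x
      eq = begin
        - x * - x     ≈⟨ -‿distribˡ-* x (- x) ⟨
        - (x * - x)   ≈⟨ -‿cong (-‿distribʳ-* x x) ⟨
        - - (x * x)   ≈⟨ -‿involutive (x * x) ⟩
        x * x         ∎

    square-bound : ∀ s t → t * t ≤ s → t ≤ 1# + s
    square-bound s t t²≤s with total t 1#
    ... | inj₁ t≤1 = ≤-trans t≤1 (≤-respˡ (+-identityʳ 1#)
                       (+-monoʳ-≤ 1# (≤-trans (square-nonneg t) t²≤s)))
    ... | inj₂ 1≤t = ≤-trans t≤t² (≤-trans t²≤s (≤-respˡ (+-identityˡ s) s≤1+s))
      where
      0≤1 : 0# ≤ 1#
      0≤1 = ≤-respʳ (*-identityˡ 1#) (square-nonneg 1#)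

      s≤1+s : 0# + s ≤ 1# + s
      s≤1+s = ≤-respˡ (+-comm s 0#) (≤-respʳ (+-comm s 1#) (+-monoʳ-≤ s 0≤1))

      0≤t-1 : 0# ≤ - 1# + t
      0≤t-1 = ≤-respˡ (-‿inverseˡ 1#) (+-monoʳ-≤ (- 1#) 1≤t)

      eq : t + t * (- 1# + t) ≈ t * t
      eq = begin
        t + t * (- 1# + t)          ≈⟨ +-congʳ (*-identityʳ t) ⟨
        t * 1# + t * (- 1# + t)     ≈⟨ distribˡ t 1# (- 1# + t) ⟨
        t * (1# + (- 1# + t))       ≈⟨ *-congˡ (+-assoc 1# (- 1#) t) ⟨
        t * ((1# + - 1#) + t)       ≈⟨ *-congˡ (+-congʳ (-‿inverseʳ 1#)) ⟩
        t * (0# + t)                ≈⟨ *-congˡ (+-identityˡ t) ⟩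
        t * t                       ∎

      t≤t² : t ≤ t * t
      t≤t² = ≤-respʳ eq (≤-respˡ (+-identityʳ t)
               (+-monoʳ-≤ t (*-nonneg (≤-trans 0≤1 1≤t) 0≤t-1)))

  -- The largest t with t * t ≤ s.
  √ : ∀ s → 0# ≤ s → Carrier
  √ s 0≤s = proj₁ (supremum (λ t → t * t ≤ s)
    (0# , ≤-respˡ (sym (zeroˡ 0#)) 0≤s)
    (1# + s , square-bound s))

  record Point : Set where
    field
      coord  : ℕ → Carrier
      bound  : ℕ
      vanish : ∀ n → bound ℕ.≤ n → coord n ≈ 0#
  open Point public

  -- Points are compared coordinatewise: bound need not be the least one.
  infix 4 _≈ₚ_
  _≈ₚ_ : Rel Point 0ℓ
  x ≈ₚ y = ∀ n → coord x n ≈ coord y n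

  infixl 6 _−ₚ_
  _−ₚ_ : Point → Point → Point
  x −ₚ y = record
    { coord  = λ n → coord x n - coord y n
    ; bound  = bound x ℕ.⊔ bound y
    ; vanish = λ n b≤n → trans
        (+-cong (vanish x n (ℕₚ.m⊔n≤o⇒m≤o (bound x) (bound y) b≤n))
                (-‿cong (vanish y n (ℕₚ.m⊔n≤o⇒n≤o (bound x) (bound y) b≤n))))
        (-‿inverseʳ 0#)
    }

  ‖_‖² : Point → Carrier
  ‖ x ‖² = ∑[ i < bound x ] (coord x (toℕ i) * coord x (toℕ i))

  private
    sum-nonneg : ∀ n (f : Fin n → Carrier) → (∀ i → 0# ≤ f i) → 0# ≤ ∑[ i < n ] f i
    sum-nonneg zero    f 0≤f = ≤-reflexive refl
    sum-nonneg (suc n) f 0≤f =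
      +-nonneg (0≤f Fin.zero) (sum-nonneg n (λ i → f (Fin.suc i)) (λ i → 0≤f (Fin.suc i)))

  ‖_‖²-nonneg : ∀ x → 0# ≤ ‖ x ‖²
  ‖ x ‖²-nonneg = sum-nonneg (bound x) _ (λ i → square-nonneg (coord x (toℕ i)))

  ‖_‖ : Point → Carrier
  ‖ x ‖ = √ ‖ x ‖² ‖ x ‖²-nonneg

  dist : Point → Point → Carrier
  dist x y = ‖ x −ₚ y ‖

  record Config : Set₁ where
    field
      mem  : Pred Point 0ℓ
      resp : mem Respects _≈ₚ_
  open Config public

  infix 4 _∈_ _⊆_ _≅_
  _∈_ : Point → Config → Set
  x ∈ A = mem A x

  _⊆_ : Config → Config → Set
  A ⊆ B = ∀ x → x ∈ A → x ∈ B

  points : Config → Setoid 0ℓ 0ℓ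
  points A = record
    { Carrier       = Σ Point (_∈ A)
    ; _≈_           = λ x y → proj₁ x ≈ₚ proj₁ y
    ; isEquivalence = record
        { refl  = λ n → refl
        ; sym   = λ p n → sym (p n)
        ; trans = λ p q n → trans (p n) (q n)
        }
    }

  _≅_ : Config → Config → Set
  A ≅ B = Σ (Bijection (points A) (points B)) λ f →
    ∀ x y → dist (proj₁ (Bijection.to f x)) (proj₁ (Bijection.to f y))
            ≈ dist (proj₁ x) (proj₁ y)

  _ContainsCopyOf_ : Config → Config → Set₁
  A ContainsCopyOf B = ∃ λ A′ → A′ ⊆ A × B ≅ A′

  _IsFreeOf_ : Config → Config → Set₁
  A IsFreeOf X = ¬ (A ContainsCopyOf X)

  HasSize : Config → ℕ → Set
  HasSize A n = Bijection (≡.setoid (Fin n)) (points A)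

  IsFinite : Config → Set
  IsFinite A = ∃ (HasSize A)

  -- At most countable.
  IsCountable : Config → Set
  IsCountable A = Injection (points A) (≡.setoid ℕ)

  Coloring : Config → ℕ → Set
  Coloring A r = Func (points A) (≡.setoid (Fin r))

  Monochromatic : ∀ A {r} → Coloring A r → Config → Set
  Monochromatic A {r} χ M =
    ∃ λ (c : Fin r) → ∀ x (x∈A : x ∈ A) → x ∈ M → Func.to χ (x , x∈A) ≡ c

  -- A ⟶ B [ r ] is the partition relation A → (B)_r.
  _⟶_[_] : Config → Config → ℕ → Set₁
  A ⟶ B [ r ] = (χ : Coloring A r) →
    ∃ λ M → M ⊆ A × B ≅ M × Monochromatic A χ M

  -- Products: the even-indexed and the odd-indexed coordinates span two
  -- orthogonal copies of ℝ^∞, whose orthogonal sum is ℝ^∞, so placing A in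
  -- the first and B in the second realises the product metric (‖‖²-split).

  evens odds : Point → Point
  evens z = record
    { coord  = λ n → coord z (2 ℕ.* n)
    ; bound  = bound z
    ; vanish = λ n b≤n → vanish z _ (ℕₚ.≤-trans b≤n (ℕₚ.m≤n*m n 2))
    }
  odds z = record
    { coord  = λ n → coord z (suc (2 ℕ.* n))
    ; bound  = bound z
    ; vanish = λ n b≤n → vanish z _ (ℕₚ.m≤n⇒m≤1+n (ℕₚ.≤-trans b≤n (ℕₚ.m≤n*m n 2)))
    }

  infixr 7 _⊗_
  _⊗_ : Config → Config → Config
  A ⊗ B = record
    { mem  = λ z → evens z ∈ A × odds z ∈ B
    ; resp = λ z≈w (a , b) → resp A (λ n → z≈w _) a , resp B (λ n → z≈w _) b
    }

  private
    S : (ℕ → Carrier) → ℕ → Carrier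
    S f n = ∑[ i < n ] f (toℕ i)

    S-vanish : ∀ n {f} → (∀ i → f i ≈ 0#) → S f n ≈ 0#
    S-vanish zero    f≈0 = refl
    S-vanish (suc n) f≈0 =
      trans (+-cong (f≈0 0) (S-vanish n (λ i → f≈0 (suc i)))) (+-identityʳ 0#)

    S-extend : ∀ {n m} {f : ℕ → Carrier} → n ℕ.≤ m → (∀ i → n ℕ.≤ i → f i ≈ 0#) → S f m ≈ S f n
    S-extend {m = m} ℕ.z≤n f≈0 = S-vanish m (λ i → f≈0 i ℕ.z≤n)
    S-extend (ℕ.s≤s n≤m) f≈0   = +-congˡ (S-extend n≤m (λ i n≤i → f≈0 (suc i) (ℕ.s≤s n≤i)))

    S-cong : ∀ n {f g} → (∀ i → f i ≈ g i) → S f n ≈ S g n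
    S-cong zero    f≈g = refl
    S-cong (suc n) f≈g = +-cong (f≈g 0) (S-cong n (λ i → f≈g (suc i)))

    S-split : ∀ n (f : ℕ → Carrier) →
              S f (2 ℕ.* n) ≈ S (λ i → f (2 ℕ.* i)) n + S (λ i → f (suc (2 ℕ.* i))) n
    S-split zero    f = sym (+-identityʳ 0#)
    S-split (suc n) f = begin
      S f (2 ℕ.* suc n)                ≡⟨ ≡.cong (S f) (2*suc n) ⟩
      f 0 + (f 1 + S f₂ (2 ℕ.* n))     ≈⟨ +-congˡ (+-congˡ (S-split n f₂)) ⟩
      f 0 + (f 1 + (e + o))            ≈⟨ +-congˡ (+-assoc (f 1) e o) ⟨
      f 0 + ((f 1 + e) + o)            ≈⟨ +-congˡ (+-congʳ (+-comm (f 1) e)) ⟩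
      f 0 + ((e + f 1) + o)            ≈⟨ +-congˡ (+-assoc e (f 1) o) ⟩
      f 0 + (e + (f 1 + o))            ≈⟨ +-assoc (f 0) e (f 1 + o) ⟨
      (f 0 + e) + (f 1 + o)            ≈⟨ +-cong (+-congˡ (S-cong n λ i → reindex i))
                                                 (+-congˡ (S-cong n λ i → reindex′ i)) ⟩
      S (λ i → f (2 ℕ.* i)) (suc n) + S (λ i → f (suc (2 ℕ.* i))) (suc n) ∎
      where
      f₂ : ℕ → Carrier
      f₂ i = f (suc (suc i))

      e o : Carrier
      e = S (λ i → f₂ (2 ℕ.* i)) n
      o = S (λ i → f₂ (suc (2 ℕ.* i))) n

      2*suc : ∀ i → 2 ℕ.* suc i ≡ suc (suc (2 ℕ.* i))
      2*suc i = ℕₚ.*-suc 2 i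

      reindex : ∀ i → f₂ (2 ℕ.* i) ≈ f (2 ℕ.* suc i)
      reindex i = reflexive (≡.cong f (≡.sym (2*suc i)))

      reindex′ : ∀ i → f₂ (suc (2 ℕ.* i)) ≈ f (suc (2 ℕ.* suc i))
      reindex′ i = reflexive (≡.cong (λ k → f (suc k)) (≡.sym (2*suc i)))

  ‖‖²-split : ∀ z → ‖ z ‖² ≈ ‖ evens z ‖² + ‖ odds z ‖²
  ‖‖²-split z = begin
    S f N            ≈⟨ S-extend {f = f} (ℕₚ.m≤n*m N 2) (λ i N≤i → trans (*-congʳ (vanish z i N≤i)) (zeroˡ (coord z i))) ⟨
    S f (2 ℕ.* N)    ≈⟨ S-split N f ⟩
    S (λ i → f (2 ℕ.* i)) N + S (λ i → f (suc (2 ℕ.* i))) N ∎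
    where
    N = bound z
    f : ℕ → Carrier
    f i = coord z i * coord z i

  box : ∀ d → (Fin d → Carrier) → Config
  box d a = record
    { mem  = λ x → (∀ i → coord x (toℕ i) ≈ 0# ⊎ coord x (toℕ i) ≈ a i)
                 × (∀ n → d ℕ.≤ n → coord x n ≈ 0#)
    ; resp = λ x≈y (p , q) →
        (λ i → Sum.map (trans (sym (x≈y _))) (trans (sym (x≈y _))) (p i)) ,
        (λ n d≤n → trans (sym (x≈y n)) (q n d≤n))
    }

  IsBrick : ℕ → Config → Set
  IsBrick d B = ∃ λ (a : Fin d → Carrier) → (∀ i → 0# < a i) × B ≅ box d a

  IsRobust : Config → Set₁
  IsRobust Y = IsCountable Y ×
    (∀ C → IsFinite C → Y ContainsCopyOf C → ∀ r → r ℕ.≥ 1 → Y ⟶ C [ r ])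

  -- Applied to finite X only.  The multiple n ×ℕ 1# is the natural number n
  -- seen as a real, so the last inequality says |Z| ≥ μ |W′|.
  IsPRamsey : Config → Set₁
  IsPRamsey X = ∃ λ W → ∃ λ μ → 0# < μ
    × (∀ r → r ℕ.≥ 1 → W ⟶ X [ r ])
    × (∀ W′ n → W′ ⊆ W → HasSize W′ n →
         ∃ λ Z → ∃ λ m → Z ⊆ W′ × HasSize Z m × Z IsFreeOf X
           × μ * (n ×ℕ 1#) ≤ m ×ℕ 1#)

{-# OPTIONS --safe #-}
module Submission where

-- A copy of F in B × Y consists of a family y in Y and, for each axis k of the
-- brick, a 0/1 label of every point.  On each axis the edge {0, a_k} is replaced
-- by a shift graph: pairs i < j, embedded so that (i, j) and (j, l) are at
-- distance a_k, while pairs taken from I × J with I, J disjoint are at squared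
-- distance 0, x_k or 2 x_k, where x_k = a_k² − 4 s.  Let W be the product of these
-- graphs with Y.  Shift graphs have infinite chromatic number, so the usual product
-- argument and the robustness of Y give W → (F)_r.  Sending each index to I or J at
-- random keeps a pair with probability 1/4, so every finite W′ ⊆ W has a subset Z
-- of density 4⁻ᵈ lying in such an I × J on each axis.  As Y is countable, s can be
-- chosen so that no nonzero sum of multiples of the x_k is the difference of a
-- squared distance of F and one of Y; a copy of F in Z would then project
-- isometrically to Y.

import Algebra.Solver.Ring as RingSolver
open import Algebra.Solver.Ring.AlmostCommutativeRing
  using (fromCommutativeRing; _-Raw-AlmostCommutative⟶_)
open import Axiom.ExcludedMiddle using (ExcludedMiddle)
open import Data.Bool.Base using (Bool; true; false)
open import Data.Fin.Base as Fin using (Fin; toℕ; fromℕ<; combine; remQuot; funToFin; finToFun)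
open import Data.Fin.Patterns
import Data.Fin.Properties as Finₚ
open import Data.Integer.Base as ℤ using (ℤ; +_; -[1+_]; _⊖_)
import Data.Integer.Properties as ℤₚ
open import Data.List.Base using (List; []; _∷_)
open import Data.List.Relation.Unary.All using (All; []; _∷_)
open import Data.List.Relation.Unary.AllPairs using (AllPairs; []; _∷_)
import Data.Maybe.Base as Maybe
open import Data.Nat.Base as ℕ using (ℕ; zero; suc; _≥_)
import Data.Nat.Properties as ℕₚ
open import Data.Product.Base using (Σ; ∃; ∃₂; _×_; _,_; proj₁; proj₂; uncurry)
open import Data.Sum.Base using (_⊎_; inj₁; inj₂)
open import Defs
open import Function.Base using (_∘_; id)
open import Function.Bundles using (Func; Injection; Bijection)
import Function.Construct.Identity as Identity
open import Function.Definitions using (Injective)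
open import Level using (0ℓ; Lift; lift; lower) renaming (suc to lsuc)
open import Relation.Binary.Definitions using (tri<; tri≈; tri>)
open import Relation.Binary.PropositionalEquality as ≡ using (_≡_; _≢_; ≢-sym)
open import Relation.Binary.Structures using (IsTotalOrder)
open import Relation.Nullary.Decidable using (Dec; yes; no; dec⇒maybe; map′; decidable-stable)
open import Relation.Nullary.Negation using (¬_; contradiction)

-- The vectors p (eᵢ + eⱼ) alone would not do. Their edges have squared length 2 p², and so do two
-- pairs of some I × J that share one end, so the distances left in Z would be tied to the a_k and
-- might combine with distances of Y to distances of F. The cure is an orthogonal component q (eᵢ -
-- eⱼ). Across an edge the middle index occurs once with each sign, so that the edge has squared
-- length 2 p² + 6 q². Inside I × J the signs are invisible, and the unit is 2 p² + 2 q². With s =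
-- q² and p given by 2 p² + 6 s = a_k², the edge stays fixed while the unit x_k = a_k² - 4 s moves
-- with s.
--
-- A coincidence between a distance of F, a distance of Y and multiplicities that are not all zero
-- is then an affine equation in s with nonzero slope, and excludes at most one value. Countably
-- many exclusions cannot exhaust an interval.

-- Finite combinatorics: pairing, shift graphs, and splitting an index set in two.

module Combinatorics where

  open import Data.Nat.Base using (_+_; _*_; _^_; _≤_; _<_; s≤s; z≤n)
  open import Data.Nat.Solver using (module +-*-Solver)
  open import Algebra.Properties.CommutativeMonoid.Sum ℕₚ.+-0-commutativeMonoid
    using (sum; sum-cong-≗; ∑-distrib-+)
  open ≡

  -- Opaque, so that the arguments of pair-injective are inferred.
  opaque
    pair : ℕ → ℕ → ℕ
    pair a b = (a + b) * (a + b) + a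

    -- Since `a ≤ s = a + b`, the value `s² + a` stays below `(s + 1)²`: the squares separate the
    -- blocks of different sums, and `a` is the offset in its block.
    pair-<-mono : ∀ {a b c d} → a + b < c + d → pair a b < pair c d
    pair-<-mono {a} {b} {c} {d} s<t = begin-strict
      s * s + a                ≤⟨ ℕₚ.+-monoʳ-≤ (s * s) (ℕₚ.≤-trans (ℕₚ.m≤m+n a b) (ℕₚ.m≤n+m s s)) ⟩
      s * s + (s + s)          <⟨ ℕₚ.n<1+n _ ⟩
      suc (s * s + (s + s))    ≡⟨ solve 1 (λ s → con 1 :+ (s :* s :+ (s :+ s)) := (con 1 :+ s) :* (con 1 :+ s)) refl s ⟩
      suc s * suc s            ≤⟨ ℕₚ.*-mono-≤ s<t s<t ⟩
      (c + d) * (c + d)        ≤⟨ ℕₚ.m≤m+n _ c ⟩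
      pair c d                 ∎
      where
      open ℕₚ.≤-Reasoning
      open +-*-Solver
      s : ℕ
      s = a + b

    pair-injective : ∀ {a b c d} → pair a b ≡ pair c d → a ≡ c × b ≡ d
    pair-injective {a} {b} {c} {d} eq with ℕₚ.<-cmp (a + b) (c + d)
    ... | tri< lt _ _ = contradiction eq (ℕₚ.<⇒≢ (pair-<-mono {a} {b} {c} {d} lt))
    ... | tri> _ _ gt = contradiction (sym eq) (ℕₚ.<⇒≢ (pair-<-mono {c} {d} {a} {b} gt))
    ... | tri≈ _ s≡t _ = a≡c , ℕₚ.+-cancelˡ-≡ c b d (subst (λ x → x + b ≡ c + d) a≡c s≡t)
      where
      a≡c : a ≡ c
      a≡c = ℕₚ.+-cancelˡ-≡ ((c + d) * (c + d)) a c (subst (λ s → s * s + a ≡ pair c d) s≡t eq)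

  funToFin-cong : ∀ {m n} {f g : Fin m → Fin n} → (∀ i → f i ≡ g i) → funToFin f ≡ funToFin g
  funToFin-cong {zero}  f≗g = refl
  funToFin-cong {suc m} f≗g = cong₂ combine (f≗g 0F) (funToFin-cong (f≗g ∘ Fin.suc))

  upperBound : ∀ {n} (f : Fin n → ℕ) → ∃ λ N → ∀ t → f t < N
  upperBound {zero}  f = 0 , λ ()
  upperBound {suc n} f with N , f<N ← upperBound (f ∘ Fin.suc) =
    suc (f 0F) ℕ.⊔ N , λ where
      0F          → ℕₚ.m≤m⊔n (suc (f 0F)) N
      (Fin.suc t) → ℕₚ.<-≤-trans (f<N t) (ℕₚ.m≤n⊔m (suc (f 0F)) N)

  -- g i k is the colour of the pair (i, i + 1 + k).  By the pigeonhole principle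
  -- two indices i < j have the same set of colours on the pairs starting there.
  shiftGraph-monochromatic : ∀ r → ∃ λ N → (g : Fin N → Fin N → Fin r) →
    ∃₂ λ i k → ∃₂ λ j l → toℕ j ≡ suc (toℕ i + toℕ k) × g i k ≡ g j l
  shiftGraph-monochromatic r = suc (2 ^ r) , λ g → let open Colours g in
    let i , j , i<j , eq = Finₚ.pigeonhole (ℕₚ.n<1+n (2 ^ r)) (funToFin ∘ colours)
        -- Here `k = j - i - 1`, so that `(i , i + 1 + k)` is the pair `(i , j)`. Its colour belongs
        -- to the common colour set of `i` and `j`, hence occurs on some pair starting at `j`.
        k = fromℕ< (ℕₚ.≤-<-trans (ℕₚ.m∸n≤m (toℕ j) (suc (toℕ i))) (Finₚ.toℕ<n j))
        l , gjl≡gik = indicator⁻ (colour? j (g i k)) (trans (sym (trans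
          (sym (Finₚ.finToFun-funToFin (colours i) (g i k)))
          (trans (cong (λ c → finToFun c (g i k)) eq) (Finₚ.finToFun-funToFin (colours j) (g i k)))))
          (indicator⁺ (colour? i (g i k)) (k , refl)))
    in i , k , j , l
     , trans (sym (ℕₚ.m+[n∸m]≡n i<j)) (cong (λ x → suc (toℕ i + x)) (sym (Finₚ.toℕ-fromℕ< _)))
     , sym gjl≡gik
    where
    module Colours (g : Fin (suc (2 ^ r)) → Fin (suc (2 ^ r)) → Fin r) where
      colour? : ∀ i c → Dec (∃ λ k → g i k ≡ c)
      colour? i c = Finₚ.any? (λ k → g i k Finₚ.≟ c)

      indicator : ∀ {P : Set} → Dec P → Fin 2
      indicator (yes _) = 1F
      indicator (no _)  = 0F

      indicator⁺ : ∀ {P : Set} (P? : Dec P) → P → indicator P? ≡ 1F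
      indicator⁺ (yes _) _ = refl
      indicator⁺ (no ¬p) p = contradiction p ¬p

      indicator⁻ : ∀ {P : Set} (P? : Dec P) → indicator P? ≡ 1F → P
      indicator⁻ (yes p) _ = p

      colours : Fin (suc (2 ^ r)) → Fin r → Fin 2
      colours i c = indicator (colour? i c)

  infixl 9 _[_≔_]
  _[_≔_] : (ℕ → ℕ) → ℕ → ℕ → ℕ → ℕ
  (f [ v ≔ x ]) n with n ℕₚ.≟ v
  ... | yes _ = x
  ... | no _  = f n

  module _ {n} (i j : Fin n → ℕ) (i≢j : ∀ t → i t ≢ j t) where

    weight : (A B : ℕ → ℕ) → Fin n → ℕ
    weight A B t = A (i t) * B (j t)

    -- A fair coin at `v` leaves the expected weight unchanged. As `i t ≢ j t`, the index `v` meets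
    -- at most one of the two factors, so the product is affine in the outcome.
    weight-average : ∀ A B v t →
      weight (A [ v ≔ A v + A v ]) (B [ v ≔ 0 ]) t + weight (A [ v ≔ 0 ]) (B [ v ≔ B v + B v ]) t
      ≡ weight A B t + weight A B t
    weight-average A B v t with i t ℕₚ.≟ v | j t ℕₚ.≟ v
    ... | yes i≡v | yes j≡v = contradiction (trans i≡v (sym j≡v)) (i≢j t)
    ... | yes refl | no _   = trans (ℕₚ.+-identityʳ _) (ℕₚ.*-distribʳ-+ (B (j t)) (A (i t)) (A (i t)))
    ... | no _ | yes refl   = trans (cong (_+ A (i t) * (B (j t) + B (j t))) (ℕₚ.*-zeroʳ (A (i t)))) (ℕₚ.*-distribˡ-+ (A (i t)) (B (j t)) (B (j t)))
    ... | no _ | no _       = refl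

    Φ : (A B : ℕ → ℕ) → ℕ
    Φ A B = sum (weight A B)

    choose : ∀ A B v → Φ A B ≤ Φ (A [ v ≔ A v + A v ]) (B [ v ≔ 0 ])
                     ⊎ Φ A B ≤ Φ (A [ v ≔ 0 ]) (B [ v ≔ B v + B v ])
    choose A B v with ℕₚ.≤-total (Φ A B) (Φ (A [ v ≔ A v + A v ]) (B [ v ≔ 0 ]))
    ... | inj₁ le = inj₁ le
    ... | inj₂ ge = inj₂ (ℕₚ.+-cancelˡ-≤ (Φ A B) _ _ (ℕₚ.≤-trans (ℕₚ.≤-reflexive total) (ℕₚ.+-monoˡ-≤ _ ge)))
      where
      total : Φ A B + Φ A B ≡ Φ (A [ v ≔ A v + A v ]) (B [ v ≔ 0 ]) + Φ (A [ v ≔ 0 ]) (B [ v ≔ B v + B v ])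
      total = trans (sym (∑-distrib-+ (weight A B) (weight A B)))
        (trans (sum-cong-≗ (λ t → sym (weight-average A B v t)))
          (∑-distrib-+ (weight (A [ v ≔ A v + A v ]) (B [ v ≔ 0 ])) (weight (A [ v ≔ 0 ]) (B [ v ≔ B v + B v ]))))

    -- The method of conditional expectations: each index v < N is put on the
    -- left (weights 2, 0) or on the right (weights 0, 2), undecided indices have
    -- weights 1, 1, and Φ / 4 is the expected number of pairs going from left to right.
    decide : ∀ N → ∃₂ λ A B → n ≤ Φ A B
      × (∀ v → N ≤ v → A v ≡ 1 × B v ≡ 1)
      × (∀ v → v < N → (A v ≡ 2 × B v ≡ 0) ⊎ (A v ≡ 0 × B v ≡ 2))
    decide zero = (λ _ → 1) , (λ _ → 1) , ℕₚ.≤-reflexive (sym (sum-ones n)) , (λ _ _ → refl , refl) , λ _ ()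
      where
      sum-ones : ∀ n → sum {n} (λ _ → 1) ≡ n
      sum-ones zero    = refl
      sum-ones (suc n) = cong suc (sum-ones n)
    decide (suc N) with decide N
    ... | A , B , n≤Φ , undecided , decided with choose A B N
    ... | inj₁ le =
      A [ N ≔ A N + A N ] , B [ N ≔ 0 ] , ℕₚ.≤-trans n≤Φ le , undecided′ , decided′
      where
      undecided′ : ∀ v → N < v → (A [ N ≔ A N + A N ]) v ≡ 1 × (B [ N ≔ 0 ]) v ≡ 1
      undecided′ v N<v with v ℕₚ.≟ N
      ... | yes v≡N = contradiction (sym v≡N) (ℕₚ.<⇒≢ N<v)
      ... | no _    = undecided v (ℕₚ.<⇒≤ N<v)
      decided′ : ∀ v → v < suc N → ((A [ N ≔ A N + A N ]) v ≡ 2 × (B [ N ≔ 0 ]) v ≡ 0)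
                                 ⊎ ((A [ N ≔ A N + A N ]) v ≡ 0 × (B [ N ≔ 0 ]) v ≡ 2)
      decided′ v (s≤s v≤N) with v ℕₚ.≟ N
      ... | yes _  = inj₁ (cong (λ x → x + x) (proj₁ (undecided N ℕₚ.≤-refl)) , refl)
      ... | no v≢N = decided v (ℕₚ.≤∧≢⇒< v≤N v≢N)
    ... | inj₂ le =
      A [ N ≔ 0 ] , B [ N ≔ B N + B N ] , ℕₚ.≤-trans n≤Φ le , undecided′ , decided′
      where
      undecided′ : ∀ v → N < v → (A [ N ≔ 0 ]) v ≡ 1 × (B [ N ≔ B N + B N ]) v ≡ 1
      undecided′ v N<v with v ℕₚ.≟ N
      ... | yes v≡N = contradiction (sym v≡N) (ℕₚ.<⇒≢ N<v)
      ... | no _    = undecided v (ℕₚ.<⇒≤ N<v)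
      decided′ : ∀ v → v < suc N → ((A [ N ≔ 0 ]) v ≡ 2 × (B [ N ≔ B N + B N ]) v ≡ 0)
                                 ⊎ ((A [ N ≔ 0 ]) v ≡ 0 × (B [ N ≔ B N + B N ]) v ≡ 2)
      decided′ v (s≤s v≤N) with v ℕₚ.≟ N
      ... | yes _  = inj₂ (refl , cong (λ x → x + x) (proj₂ (undecided N ℕₚ.≤-refl)))
      ... | no v≢N = decided v (ℕₚ.≤∧≢⇒< v≤N v≢N)

  -- Every nonzero term contributes at most `b`, so a large sum forces many nonzero terms; `φ`
  -- enumerates them.
  select : ∀ {n} (f : Fin n → ℕ) {b} → (∀ t → f t ≤ b) →
    ∃₂ λ m (φ : Fin m → Fin n) → Injective _≡_ _≡_ φ × (∀ a → f (φ a) ≢ 0) × sum f ≤ b * m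
  select {zero}  f {b} f≤b = 0 , (λ ()) , (λ { {()} }) , (λ ()) , z≤n
  select {suc n} f {b} f≤b with select (f ∘ Fin.suc) (f≤b ∘ Fin.suc) | f 0F in f0≡
  ... | m , φ , φ-inj , f≢0 , le | zero =
    m , Fin.suc ∘ φ , φ-inj ∘ Finₚ.suc-injective , f≢0 , le
  ... | m , φ , φ-inj , f≢0 , le | suc x = suc m , φ′ , φ′-inj , f≢0′ , (begin
    suc x + sum (f ∘ Fin.suc) ≤⟨ ℕₚ.+-mono-≤ (subst (_≤ b) f0≡ (f≤b 0F)) le ⟩
    b + b * m                 ≡⟨ ℕₚ.*-suc b m ⟨
    b * suc m                 ∎)
    where
    open ℕₚ.≤-Reasoning
    φ′ : Fin (suc m) → Fin (suc n)
    φ′ 0F          = 0F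
    φ′ (Fin.suc a) = Fin.suc (φ a)
    φ′-inj : Injective _≡_ _≡_ φ′
    φ′-inj {0F}        {0F}        _  = refl
    φ′-inj {Fin.suc a} {Fin.suc b} eq = cong Fin.suc (φ-inj (Finₚ.suc-injective eq))
    f≢0′ : ∀ a → f (φ′ a) ≢ 0
    f≢0′ 0F          eq = contradiction (trans (sym f0≡) eq) λ ()
    f≢0′ (Fin.suc a) eq = f≢0 a eq

  -- Once all indices below a common bound are decided, a pair weighs 4 if it goes from left to
  -- right and 0 otherwise. Total weight at least `n` therefore leaves at least `n / 4` such pairs,
  -- and no left index is a right one.
  separate : ∀ {n} (i j : Fin n → ℕ) → (∀ t → i t < j t) →
    ∃₂ λ m (φ : Fin m → Fin n) → Injective _≡_ _≡_ φ × n ≤ 4 * m × (∀ a b → i (φ a) ≢ j (φ b))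
  separate {n} i j i<j with upperBound j
  ... | N , j<N with decide i j (ℕₚ.<⇒≢ ∘ i<j) N
  ... | A , B , n≤Φ , _ , decided with select (weight i j (ℕₚ.<⇒≢ ∘ i<j) A B) {4} weight≤4
    where
    A≤2 : ∀ v → v < N → A v ≤ 2
    A≤2 v v<N with decided v v<N
    ... | inj₁ (eq , _) = ℕₚ.≤-reflexive eq
    ... | inj₂ (eq , _) = ℕₚ.≤-trans (ℕₚ.≤-reflexive eq) z≤n

    B≤2 : ∀ v → v < N → B v ≤ 2
    B≤2 v v<N with decided v v<N
    ... | inj₁ (_ , eq) = ℕₚ.≤-trans (ℕₚ.≤-reflexive eq) z≤n
    ... | inj₂ (_ , eq) = ℕₚ.≤-reflexive eq

    weight≤4 : ∀ t → A (i t) * B (j t) ≤ 4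
    weight≤4 t = ℕₚ.*-mono-≤ (A≤2 (i t) (ℕₚ.<-trans (i<j t) (j<N t))) (B≤2 (j t) (j<N t))
  ... | m , φ , φ-inj , weight≢0 , Φ≤4m = m , φ , φ-inj , ℕₚ.≤-trans n≤Φ Φ≤4m , disjoint
    where
    disjoint : ∀ a b → i (φ a) ≢ j (φ b)
    disjoint a b eq with decided (j (φ b)) (j<N (φ b))
    ... | inj₁ (_ , B≡0) = weight≢0 b (trans (cong (A (i (φ b)) *_) B≡0) (ℕₚ.*-zeroʳ (A (i (φ b)))))
    ... | inj₂ (A≡0 , _) = weight≢0 a (cong (_* B (j (φ a))) (trans (cong A eq) A≡0))

-- A ring solver with integer coefficients.

module IntegerCoefficients (ℝ : CompleteOrderedField) where

  open CompleteOrderedField ℝ hiding (zero)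
  open import Algebra.Properties.Ring ring
  open import Algebra.Properties.Semiring.Mult.TCOptimised semiring
    renaming (_×_ to _·_; ×-homo-+ to ·-homo-+; ×1-homo-* to ·1-homo-*)
  open import Relation.Binary.Reasoning.Setoid setoid

  private
    -- With the optimised multiple, `+ 0` and `+ 1` evaluate to `0#` and `1#` themselves, so
    -- `con (+ 1)` in a solver call stands for `1#`.
    ⟦_⟧ : ℤ → Carrier
    ⟦ + n ⟧      = n · 1#
    ⟦ -[1+ n ] ⟧ = - (suc n · 1#)

    suc· : ∀ n → suc n · 1# ≈ 1# + n · 1#
    suc· n = ·-homo-+ 1# 1 n

    cancel-1 : ∀ x y → (1# + x) - (1# + y) ≈ x - y
    cancel-1 x y = begin
      (1# + x) + - (1# + y)      ≈⟨ +-cong (+-comm 1# x) (sym (-‿+-comm 1# y)) ⟩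
      (x + 1#) + (- 1# + - y)    ≈⟨ +-assoc x 1# _ ⟩
      x + (1# + (- 1# + - y))    ≈⟨ +-congˡ (sym (+-assoc 1# (- 1#) (- y))) ⟩
      x + ((1# + - 1#) + - y)    ≈⟨ +-congˡ (+-congʳ (-‿inverseʳ 1#)) ⟩
      x + (0# + - y)             ≈⟨ +-congˡ (+-identityˡ (- y)) ⟩
      x - y                      ∎

    ⊖-homo : ∀ m n → ⟦ m ⊖ n ⟧ ≈ m · 1# - n · 1#
    ⊖-homo m zero = sym (trans (+-congˡ -0#≈0#) (+-identityʳ _))
    ⊖-homo zero (suc n) = sym (+-identityˡ _)
    ⊖-homo (suc m) (suc n) = begin
      ⟦ suc m ⊖ suc n ⟧               ≡⟨ ≡.cong ⟦_⟧ (ℤₚ.[1+m]⊖[1+n]≡m⊖n m n) ⟩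
      ⟦ m ⊖ n ⟧                       ≈⟨ ⊖-homo m n ⟩
      m · 1# - n · 1#                 ≈⟨ cancel-1 _ _ ⟨
      (1# + m · 1#) - (1# + n · 1#)   ≈⟨ +-cong (suc· m) (-‿cong (suc· n)) ⟨
      suc m · 1# - suc n · 1#         ∎

    +-homo : ∀ i j → ⟦ i ℤ.+ j ⟧ ≈ ⟦ i ⟧ + ⟦ j ⟧
    +-homo (+ m)      (+ n)      = ·-homo-+ 1# m n
    +-homo (+ m)      -[1+ n ]   = ⊖-homo m (suc n)
    +-homo -[1+ m ]   (+ n)      = trans (⊖-homo n (suc m)) (+-comm _ _)
    +-homo -[1+ m ]   -[1+ n ]   = begin
      - (suc (suc (m ℕ.+ n)) · 1#)       ≡⟨ ≡.cong (λ k → - (suc k · 1#)) (≡.sym (ℕₚ.+-suc m n)) ⟩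
      - ((suc m ℕ.+ suc n) · 1#)         ≈⟨ -‿cong (·-homo-+ 1# (suc m) (suc n)) ⟩
      - (suc m · 1# + suc n · 1#)        ≈⟨ -‿+-comm _ _ ⟨
      - (suc m · 1#) + - (suc n · 1#)    ∎

    -‿homo : ∀ i → ⟦ ℤ.- i ⟧ ≈ - ⟦ i ⟧
    -‿homo (+ zero)    = sym -0#≈0#
    -‿homo (+ (suc n)) = refl
    -‿homo -[1+ n ]    = sym (-‿involutive _)

    ℕ*-homo : ∀ m j → ⟦ + m ℤ.* j ⟧ ≈ m · 1# * ⟦ j ⟧
    ℕ*-homo m (+ n) =
      trans (reflexive (≡.cong ⟦_⟧ (≡.sym (ℤₚ.pos-* m n)))) (·1-homo-* m n)
    ℕ*-homo m j@(-[1+ n ]) = begin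
      ⟦ + m ℤ.* j ⟧                      ≡⟨ ≡.cong ⟦_⟧ (≡.sym (ℤₚ.neg-distribʳ-* (+ m) (+ suc n))) ⟩
      ⟦ ℤ.- (+ m ℤ.* + suc n) ⟧          ≈⟨ -‿homo (+ m ℤ.* + suc n) ⟩
      - ⟦ + m ℤ.* + suc n ⟧              ≈⟨ -‿cong (ℕ*-homo m (+ suc n)) ⟩
      - (m · 1# * (suc n · 1#))          ≈⟨ -‿distribʳ-* _ _ ⟩
      m · 1# * ⟦ j ⟧                     ∎

    *-homo : ∀ i j → ⟦ i ℤ.* j ⟧ ≈ ⟦ i ⟧ * ⟦ j ⟧
    *-homo (+ m) j = ℕ*-homo m j
    *-homo i@(-[1+ m ]) j = begin
      ⟦ i ℤ.* j ⟧                        ≡⟨ ≡.cong ⟦_⟧ (≡.sym (ℤₚ.neg-distribˡ-* (+ suc m) j)) ⟩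
      ⟦ ℤ.- (+ suc m ℤ.* j) ⟧            ≈⟨ -‿homo (+ suc m ℤ.* j) ⟩
      - ⟦ + suc m ℤ.* j ⟧                ≈⟨ -‿cong (ℕ*-homo (suc m) j) ⟩
      - (suc m · 1# * ⟦ j ⟧)             ≈⟨ -‿distribˡ-* _ _ ⟩
      ⟦ i ⟧ * ⟦ j ⟧                      ∎

    morphism : ℤ.+-*-rawRing -Raw-AlmostCommutative⟶ fromCommutativeRing commutativeRing
    morphism = record
      { ⟦_⟧    = ⟦_⟧
      ; +-homo = +-homo
      ; *-homo = *-homo
      ; -‿homo = -‿homo
      ; 0-homo = refl
      ; 1-homo = refl
      }

  open RingSolver ℤ.+-*-rawRing (fromCommutativeRing commutativeRing) morphism
    (λ i j → Maybe.map (λ eq → reflexive (≡.cong ⟦_⟧ eq)) (dec⇒maybe (i ℤₚ.≟ j))) public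
    using (solve; con; _:+_; _:*_; _:-_; :-_; _:=_)

-- Consequences of the ordered field axioms.

module OrderedField (em : ExcludedMiddle (lsuc 0ℓ)) (ℝ : CompleteOrderedField) where

  open CompleteOrderedField ℝ hiding (zero)
  open IsTotalOrder isTotalOrder public using (total; antisym)
    renaming (trans to ≤-trans; reflexive to ≤-reflexive; ≤-respˡ-≈ to ≤-respˡ; ≤-respʳ-≈ to ≤-respʳ)
  open IntegerCoefficients ℝ
  open import Algebra.Properties.Monoid.Mult +-monoid using (×-congʳ) renaming (_×_ to _×ℕ_)
  open import Algebra.Properties.Semiring.Mult semiring using (×-assoc-*)
  open import Algebra.Properties.Ring ring using (x∙y⁻¹≈ε⇒x≈y; x≈y⇒x∙y⁻¹≈ε; x[y-z]≈xy-xz)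
  open import Relation.Binary.Reasoning.Setoid setoid

  lem : (P : Set) → Dec P
  lem P = map′ lower lift (em {Lift (lsuc 0ℓ) P})

  ≤-refl : ∀ {x} → x ≤ x
  ≤-refl = ≤-reflexive refl

  +-mono-≤ : ∀ {x y z w} → x ≤ y → z ≤ w → x + z ≤ y + w
  +-mono-≤ {x} {y} {z} {w} x≤y z≤w =
    ≤-trans (+-monoʳ-≤ x z≤w) (≤-respˡ (+-comm w x) (≤-respʳ (+-comm w y) (+-monoʳ-≤ w x≤y)))

  x≤y⇒0≤y-x : ∀ {x y} → x ≤ y → 0# ≤ y - x
  x≤y⇒0≤y-x {x} {y} x≤y = ≤-respˡ (-‿inverseˡ x) (≤-respʳ (+-comm (- x) y) (+-monoʳ-≤ (- x) x≤y))

  0≤y-x⇒x≤y : ∀ {x y} → 0# ≤ y - x → x ≤ y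
  0≤y-x⇒x≤y {x} {y} 0≤ = ≤-respˡ (+-identityʳ x)
    (≤-respʳ (solve 2 (λ x y → x :+ (y :- x) := y) refl x y) (+-monoʳ-≤ x 0≤))

  *-monoʳ-≤ : ∀ {x y z} → 0# ≤ x → y ≤ z → x * y ≤ x * z
  *-monoʳ-≤ {x} {y} {z} 0≤x y≤z = 0≤y-x⇒x≤y
    (≤-respʳ (solve 3 (λ x y z → x :* (z :- y) := x :* z :- x :* y) refl x y z)
      (*-nonneg 0≤x (x≤y⇒0≤y-x y≤z)))

  +-nonneg : ∀ {x y} → 0# ≤ x → 0# ≤ y → 0# ≤ x + y
  +-nonneg 0≤x 0≤y = ≤-respˡ (+-identityʳ 0#) (+-mono-≤ 0≤x 0≤y)

  square-nonneg : ∀ x → 0# ≤ x * x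
  square-nonneg x with total 0# x
  ... | inj₁ 0≤x = *-nonneg 0≤x 0≤x
  ... | inj₂ x≤0 = ≤-respʳ (solve 1 (λ x → (con (+ 0) :- x) :* (con (+ 0) :- x) := x :* x) refl x)
                     (*-nonneg (x≤y⇒0≤y-x x≤0) (x≤y⇒0≤y-x x≤0))

  0≤1 : 0# ≤ 1#
  0≤1 = ≤-respʳ (*-identityˡ 1#) (square-nonneg 1#)

  0<1 : 0# < 1#
  0<1 = 0≤1 , 0≉1

  0≤x+y≈0⇒x≈0 : ∀ {x y} → 0# ≤ x → 0# ≤ y → x + y ≈ 0# → x ≈ 0#
  0≤x+y≈0⇒x≈0 {x} {y} 0≤x 0≤y x+y≈0 = antisym
    (≤-respʳ x+y≈0 (≤-respˡ (+-identityʳ x) (+-monoʳ-≤ x 0≤y))) 0≤x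

  0<x⇒0<x+y : ∀ {x y} → 0# < x → 0# ≤ y → 0# < x + y
  0<x⇒0<x+y (0≤x , x≉0) 0≤y =
    +-nonneg 0≤x 0≤y , λ eq → x≉0 (sym (0≤x+y≈0⇒x≈0 0≤x 0≤y (sym eq)))

  x*y≈0⇒y≈0 : ∀ {x y} → ¬ (x ≈ 0#) → x * y ≈ 0# → y ≈ 0#
  x*y≈0⇒y≈0 {x} {y} x≉0 xy≈0 with w , xw≈1 ← inverse x x≉0 =
    trans (sym (*-identityˡ y)) (trans (*-congʳ (sym xw≈1))
      (trans (solve 3 (λ x w y → (x :* w) :* y := w :* (x :* y)) refl x w y)
        (trans (*-congˡ xy≈0) (zeroʳ w))))

  *-pos : ∀ {x y} → 0# < x → 0# < y → 0# < x * y
  *-pos (0≤x , 0≉x) (0≤y , 0≉y) = *-nonneg 0≤x 0≤y ,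
    λ 0≈xy → 0≉y (sym (x*y≈0⇒y≈0 (λ x≈0 → 0≉x (sym x≈0)) (sym 0≈xy)))

  reciprocal : ∀ {x} → 0# < x → ∃ λ y → 0# < y × x * y ≈ 1#
  reciprocal {x} (0≤x , 0≉x) with y , xy≈1 ← inverse x (λ x≈0 → 0≉x (sym x≈0)) =
    y , (0≤y , λ 0≈y → 0≉1 (trans (sym (zeroʳ x)) (trans (*-congˡ 0≈y) xy≈1))) , xy≈1
    where
    0≤y : 0# ≤ y
    0≤y with total 0# y
    ... | inj₁ 0≤y = 0≤y
    ... | inj₂ y≤0 = contradiction
      (antisym 0≤1 (≤-respˡ xy≈1 (≤-respʳ (zeroʳ x) (*-monoʳ-≤ 0≤x y≤0)))) 0≉1

  *-cancel-0≤ : ∀ {x y} → 0# < x → 0# ≤ x * y → 0# ≤ y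
  *-cancel-0≤ {x} {y} 0<x 0≤xy with w , (0≤w , _) , xw≈1 ← reciprocal 0<x =
    ≤-respʳ (trans (solve 3 (λ x w y → w :* (x :* y) := (x :* w) :* y) refl x w y)
              (trans (*-congʳ xw≈1) (*-identityˡ y)))
      (*-nonneg 0≤w 0≤xy)

  x*x≈0⇒x≈0 : ∀ {x} → x * x ≈ 0# → x ≈ 0#
  x*x≈0⇒x≈0 {x} x²≈0 = decidable-stable (lem (x ≈ 0#)) λ x≉0 → x≉0 (x*y≈0⇒y≈0 x≉0 x²≈0)

  square-reflects-≤ : ∀ {x y} → 0# ≤ y → x * x ≤ y * y → x ≤ y
  square-reflects-≤ {x} {y} 0≤y x²≤y² with total x y
  ... | inj₁ x≤y = x≤y
  ... | inj₂ y≤x = 0≤y-x⇒x≤y (≤-reflexive (begin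
    0#        ≈⟨ zeroʳ (- 1#) ⟨
    - 1# * 0# ≈⟨ *-congˡ (x*x≈0⇒x≈0 (antisym [x-y]²≤0 (square-nonneg (x - y)))) ⟨
    - 1# * (x - y) ≈⟨ solve 2 (λ x y → (:- con (+ 1)) :* (x :- y) := y :- x) refl x y ⟩
    y - x ∎))
    where
    0≤x-y = x≤y⇒0≤y-x y≤x
    -- `- (x - y)²` is the sum of the nonnegative quantities `y² - x²` and `2 y (x - y)`.
    [x-y]²≤0 : (x - y) * (x - y) ≤ 0#
    [x-y]²≤0 =
      0≤y-x⇒x≤y (≤-respʳ (solve 2 (λ x y →
          (y :* y :- x :* x) :+ ((x :- y) :* y :+ (x :- y) :* y)
          := con (+ 0) :- (x :- y) :* (x :- y)) refl x y)
        (+-nonneg (x≤y⇒0≤y-x x²≤y²) (+-nonneg (*-nonneg 0≤x-y 0≤y) (*-nonneg 0≤x-y 0≤y))))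

  ×ℕ-nonneg : ∀ n {x} → 0# ≤ x → 0# ≤ n ×ℕ x
  ×ℕ-nonneg zero    0≤x = ≤-refl
  ×ℕ-nonneg (suc n) 0≤x = +-nonneg 0≤x (×ℕ-nonneg n 0≤x)

  ×ℕ-pos : ∀ n {x} → 0# < x → 0# < suc n ×ℕ x
  ×ℕ-pos n 0<x = 0<x⇒0<x+y 0<x (×ℕ-nonneg n (proj₁ 0<x))

  ×ℕ-monoˡ-≤ : ∀ {m n x} → 0# ≤ x → m ℕ.≤ n → m ×ℕ x ≤ n ×ℕ x
  ×ℕ-monoˡ-≤ {n = n} 0≤x ℕ.z≤n = ×ℕ-nonneg n 0≤x
  ×ℕ-monoˡ-≤ {x = x} 0≤x (ℕ.s≤s m≤n) = +-monoʳ-≤ x (×ℕ-monoˡ-≤ 0≤x m≤n)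

  ×ℕ-monoʳ-≤ : ∀ n {x y} → x ≤ y → n ×ℕ x ≤ n ×ℕ y
  ×ℕ-monoʳ-≤ zero    x≤y = ≤-refl
  ×ℕ-monoʳ-≤ (suc n) x≤y = +-mono-≤ x≤y (×ℕ-monoʳ-≤ n x≤y)

  ×ℕ-cancel-≈ : ∀ n {x y} → suc n ×ℕ x ≈ suc n ×ℕ y → x ≈ y
  ×ℕ-cancel-≈ n {x} {y} eq = x∙y⁻¹≈ε⇒x≈y x y (x*y≈0⇒y≈0 n≉0 (begin
    (suc n ×ℕ 1#) * (x - y)                    ≈⟨ x[y-z]≈xy-xz _ x y ⟩
    (suc n ×ℕ 1#) * x - (suc n ×ℕ 1#) * y      ≈⟨ +-cong (n×x x) (-‿cong (n×x y)) ⟩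
    suc n ×ℕ x - suc n ×ℕ y                    ≈⟨ x≈y⇒x∙y⁻¹≈ε eq ⟩
    0#                                         ∎))
    where
    n≉0 : ¬ (suc n ×ℕ 1# ≈ 0#)
    n≉0 n≈0 = proj₂ (×ℕ-pos n 0<1) (sym n≈0)
    n×x : ∀ x → (suc n ×ℕ 1#) * x ≈ suc n ×ℕ x
    n×x x = trans (×-assoc-* (suc n) 1# x) (×-congʳ (suc n) (*-identityˡ x))

  ½ : Carrier
  ½ = proj₁ (reciprocal (0<x⇒0<x+y 0<1 0≤1))

  0<½ : 0# < ½
  0<½ = proj₁ (proj₂ (reciprocal (0<x⇒0<x+y 0<1 0≤1)))

  ½x+½x≈x : ∀ x → ½ * x + ½ * x ≈ x
  ½x+½x≈x x = trans (solve 2 (λ h x → h :* x :+ h :* x := ((con (+ 1) :+ con (+ 1)) :* h) :* x) refl ½ x)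
    (trans (*-congʳ (proj₂ (proj₂ (reciprocal (0<x⇒0<x+y 0<1 0≤1))))) (*-identityˡ x))

-- The supremum `√ s` squares to `s`.

module SquareRoot (em : ExcludedMiddle (lsuc 0ℓ)) (ℝ : CompleteOrderedField) where

  open CompleteOrderedField ℝ hiding (zero)
  open Configurations ℝ using (√)
  open OrderedField em ℝ
  open IntegerCoefficients ℝ

  √-upper : ∀ s 0≤s t → t * t ≤ s → t ≤ √ s 0≤s
  √-upper s 0≤s = proj₁ (proj₂ (supremum (λ t → t * t ≤ s) _ _))

  √-least : ∀ s 0≤s u → (∀ t → t * t ≤ s → t ≤ u) → √ s 0≤s ≤ u
  √-least s 0≤s = proj₂ (proj₂ (supremum (λ t → t * t ≤ s) _ _))

  √-nonneg : ∀ s 0≤s → 0# ≤ √ s 0≤s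
  √-nonneg s 0≤s = √-upper s 0≤s 0# (≤-respˡ (sym (zeroˡ 0#)) 0≤s)

  √-square : ∀ s 0≤s → √ s 0≤s * √ s 0≤s ≈ s
  √-square s 0≤s = antisym t²≤s s≤t²
    where
    t c k : Carrier
    t = √ s 0≤s
    -- A positive number whose square is at least `s`, since `(1 + s)² - s = 1 + s + s²`.
    c = 1# + s
    k = t + c

    0≤t : 0# ≤ t
    0≤t = √-nonneg s 0≤s

    0<k : 0# < k
    0<k with 0≤ , 0≉ ← 0<x⇒0<x+y (0<x⇒0<x+y 0<1 0≤s) 0≤t =
      ≤-respʳ (+-comm c t) 0≤ , λ 0≈k → 0≉ (trans 0≈k (+-comm t c))

    w : Carrier
    w = proj₁ (reciprocal 0<k)

    kw≈1 : k * w ≈ 1#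
    kw≈1 = proj₂ (proj₂ (reciprocal 0<k))

    -- A Newton-like step: u lies between t and √ s, because
    -- k² (s − u²) = (c² − s) (s − t²) and k (u − t) = s − t².
    u : Carrier
    u = (s + c * t) * w

    0≤u : 0# ≤ u
    0≤u = *-nonneg (+-nonneg 0≤s (*-nonneg (proj₁ (0<x⇒0<x+y 0<1 0≤s)) 0≤t))
                   (proj₁ (proj₁ (proj₂ (reciprocal 0<k))))

    ku : k * u ≈ s + c * t
    ku = trans (solve 3 (λ k w e → k :* (e :* w) := (k :* w) :* e) refl k w (s + c * t))
           (trans (*-congʳ kw≈1) (*-identityˡ _))

    k[u-t] : k * (u - t) ≈ s - t * t
    k[u-t] = trans (solve 3 (λ k u t → k :* (u :- t) := k :* u :- k :* t) refl k u t)
      (trans (+-congʳ ku) (solve 3 (λ s c t → (s :+ c :* t) :- (t :+ c) :* t := s :- t :* t) refl s c t))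

    k²[s-u²] : (k * k) * (s - u * u) ≈ (c * c - s) * (s - t * t)
    k²[s-u²] = trans (solve 3 (λ k u s → (k :* k) :* (s :- u :* u) := k :* k :* s :- (k :* u) :* (k :* u)) refl k u s)
      (trans (+-congˡ (-‿cong (*-cong ku ku)))
        (solve 3 (λ s c t → (t :+ c) :* (t :+ c) :* s :- (s :+ c :* t) :* (s :+ c :* t)
                            := (c :* c :- s) :* (s :- t :* t)) refl s c t))

    0≤c²-s : 0# ≤ c * c - s
    0≤c²-s = ≤-respʳ (solve 1 (λ s → con (+ 1) :+ (s :+ s :* s) := (con (+ 1) :+ s) :* (con (+ 1) :+ s) :- s) refl s)
      (+-nonneg 0≤1 (+-nonneg 0≤s (*-nonneg 0≤s 0≤s)))

    -- If `t² ≤ s`, then `u² ≤ s`, hence `u ≤ t` and `s - t² = k (u - t) ≤ 0`. Dually, if `s ≤ t²`,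
    -- then `s ≤ u²` makes `u` an upper bound, hence `t ≤ u` and `s - t² ≥ 0`.
    s≤t² : s ≤ t * t
    s≤t² with total s (t * t)
    ... | inj₁ s≤t² = s≤t²
    ... | inj₂ t²≤s = 0≤y-x⇒x≤y (≤-respʳ
        (trans (solve 3 (λ k u t → k :* (t :- u) := :- (k :* (u :- t))) refl k u t)
          (trans (-‿cong k[u-t]) (solve 2 (λ s t → :- (s :- t :* t) := t :* t :- s) refl s t)))
        (*-nonneg (proj₁ 0<k) (x≤y⇒0≤y-x (√-upper s 0≤s u (0≤y-x⇒x≤y (*-cancel-0≤ (*-pos 0<k 0<k)
          (≤-respʳ (sym k²[s-u²]) (*-nonneg 0≤c²-s (x≤y⇒0≤y-x t²≤s)))))))))

    t²≤s : t * t ≤ s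
    t²≤s with total (t * t) s
    ... | inj₁ t²≤s = t²≤s
    ... | inj₂ s≤t² = 0≤y-x⇒x≤y (≤-respʳ k[u-t] (*-nonneg (proj₁ 0<k) (x≤y⇒0≤y-x
        (√-least s 0≤s u λ v v²≤s → square-reflects-≤ 0≤u (≤-trans v²≤s s≤u²)))))
      where
      s≤u² : s ≤ u * u
      s≤u² = 0≤y-x⇒x≤y (*-cancel-0≤ (*-pos 0<k 0<k) (≤-respʳ
        (trans (solve 3 (λ c s t → (c :* c :- s) :* (t :* t :- s) := :- ((c :* c :- s) :* (s :- t :* t))) refl c s t)
          (trans (-‿cong (sym k²[s-u²]))
            (solve 3 (λ k u s → :- ((k :* k) :* (s :- u :* u)) := (k :* k) :* (u :* u :- s)) refl k u s)))
        (*-nonneg 0≤c²-s (x≤y⇒0≤y-x s≤t²))))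

  √-cong : ∀ {s s′} 0≤s 0≤s′ → s ≈ s′ → √ s 0≤s ≈ √ s′ 0≤s′
  √-cong {s} {s′} 0≤s 0≤s′ s≈s′ = antisym
    (√-least s 0≤s _ λ t t²≤s → √-upper s′ 0≤s′ t (≤-respʳ s≈s′ t²≤s))
    (√-least s′ 0≤s′ _ λ t t²≤s′ → √-upper s 0≤s t (≤-respʳ (sym s≈s′) t²≤s′))

  √-injective : ∀ {s s′} 0≤s 0≤s′ → √ s 0≤s ≈ √ s′ 0≤s′ → s ≈ s′
  √-injective 0≤s 0≤s′ eq =
    trans (sym (√-square _ 0≤s)) (trans (*-cong eq eq) (√-square _ 0≤s′))

-- Squared distances, orthogonal sums, and the vectors of the shift graph.

module Geometry (em : ExcludedMiddle (lsuc 0ℓ)) (ℝ : CompleteOrderedField) where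

  open CompleteOrderedField ℝ hiding (zero)
  open Configurations ℝ
  open IntegerCoefficients ℝ
  open OrderedField em ℝ
  open SquareRoot em ℝ
  open import Algebra.Properties.CommutativeMonoid.Sum +-commutativeMonoid using (sum-syntax; sum-cong-≋)
  open import Algebra.Properties.Ring ring using (x∙y⁻¹≈ε⇒x≈y)
  open import Algebra.Properties.CommutativeMonoid.Mult +-commutativeMonoid using (×-distrib-+)
  open import Algebra.Properties.Monoid.Mult +-monoid using () renaming (_×_ to _×ℕ_)
  open import Relation.Binary.Reasoning.Setoid setoid

  sumSq : ℕ → (ℕ → Carrier) → Carrier
  sumSq N f = ∑[ i < N ] (f (toℕ i) * f (toℕ i))

  sumSq-cong : ∀ N {f g} → (∀ n → f n ≈ g n) → sumSq N f ≈ sumSq N g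
  sumSq-cong N f≈g = sum-cong-≋ {N} (λ i → *-cong (f≈g (toℕ i)) (f≈g (toℕ i)))

  sumSq-nonneg : ∀ N f → 0# ≤ sumSq N f
  sumSq-nonneg zero    f = ≤-refl
  sumSq-nonneg (suc N) f = +-nonneg (square-nonneg (f 0)) (sumSq-nonneg N (f ∘ suc))

  sumSq-zero : ∀ N {f} → (∀ n → f n ≈ 0#) → sumSq N f ≈ 0#
  sumSq-zero zero    f≈0 = refl
  sumSq-zero (suc N) f≈0 =
    trans (+-cong (trans (*-congʳ (f≈0 0)) (zeroˡ _)) (sumSq-zero N (f≈0 ∘ suc))) (+-identityʳ 0#)

  sumSq-extend : ∀ {m N f} → m ℕ.≤ N → (∀ n → m ℕ.≤ n → f n ≈ 0#) → sumSq m f ≈ sumSq N f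
  sumSq-extend {N = N} ℕ.z≤n f≈0 = sym (sumSq-zero N (λ n → f≈0 n ℕ.z≤n))
  sumSq-extend (ℕ.s≤s m≤N) f≈0 = +-congˡ (sumSq-extend m≤N (λ n m≤n → f≈0 (suc n) (ℕ.s≤s m≤n)))

  sumSq≈0 : ∀ N {f} → sumSq N f ≈ 0# → ∀ n → n ℕ.< N → f n ≈ 0#
  sumSq≈0 (suc N) {f} eq zero _ =
    x*x≈0⇒x≈0 (0≤x+y≈0⇒x≈0 (square-nonneg (f 0)) (sumSq-nonneg N (f ∘ suc)) eq)
  sumSq≈0 (suc N) {f} eq (suc n) (ℕ.s≤s n<N) =
    sumSq≈0 N (0≤x+y≈0⇒x≈0 (sumSq-nonneg N (f ∘ suc)) (square-nonneg (f 0)) (trans (+-comm _ _) eq)) n n<N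

  -- The bounds of two points may differ even when the points are equal, so norms are compared only
  -- after padding both sums to a common length.
  ‖‖²≈sumSq : ∀ x {N} → bound x ℕ.≤ N → ‖ x ‖² ≈ sumSq N (coord x)
  ‖‖²≈sumSq x b≤N = sumSq-extend b≤N (vanish x)

  ‖‖²-cong : ∀ x y → x ≈ₚ y → ‖ x ‖² ≈ ‖ y ‖²
  ‖‖²-cong x y x≈y = begin
    ‖ x ‖²              ≈⟨ ‖‖²≈sumSq x (ℕₚ.m≤m⊔n (bound x) (bound y)) ⟩
    sumSq N (coord x)   ≈⟨ sumSq-cong N x≈y ⟩
    sumSq N (coord y)   ≈⟨ ‖‖²≈sumSq y (ℕₚ.m≤n⊔m (bound x) (bound y)) ⟨
    ‖ y ‖²              ∎
    where N = bound x ℕ.⊔ bound y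

  ≈ₚ-refl : ∀ {x} → x ≈ₚ x
  ≈ₚ-refl n = refl

  ≈ₚ-sym : ∀ {x y} → x ≈ₚ y → y ≈ₚ x
  ≈ₚ-sym x≈y n = sym (x≈y n)

  ≈ₚ-trans : ∀ {x y z} → x ≈ₚ y → y ≈ₚ z → x ≈ₚ z
  ≈ₚ-trans x≈y y≈z n = trans (x≈y n) (y≈z n)

  -- Squared distances are additive over products and polynomial in the coordinates; all geometry
  -- below is done with them, and `dist²⇒dist` and `dist⇒dist²` translate at the end.
  dist² : Point → Point → Carrier
  dist² x y = ‖ x −ₚ y ‖²

  dist²-cong : ∀ {x x′ y y′} → x ≈ₚ x′ → y ≈ₚ y′ → dist² x y ≈ dist² x′ y′
  dist²-cong {x} {x′} {y} {y′} x≈x′ y≈y′ = ‖‖²-cong (x −ₚ y) (x′ −ₚ y′) (λ n → +-cong (x≈x′ n) (-‿cong (y≈y′ n)))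

  dist²-sym : ∀ x y → dist² x y ≈ dist² y x
  dist²-sym x y = begin
    dist² x y                        ≈⟨ ‖‖²≈sumSq (x −ₚ y) ℕₚ.≤-refl ⟩
    sumSq N (coord (x −ₚ y))         ≈⟨ sum-cong-≋ {N} (λ i → solve 2 (λ a b → (a :- b) :* (a :- b) := (b :- a) :* (b :- a)) refl
                                          (coord x (toℕ i)) (coord y (toℕ i))) ⟩
    sumSq N (coord (y −ₚ x))         ≈⟨ ‖‖²≈sumSq (y −ₚ x) (ℕₚ.≤-reflexive (ℕₚ.⊔-comm (bound y) (bound x))) ⟨
    dist² y x                        ∎
    where N = bound x ℕ.⊔ bound y

  dist²≈0⇒≈ₚ : ∀ {x y} → dist² x y ≈ 0# → x ≈ₚ y
  dist²≈0⇒≈ₚ {x} {y} eq n with n ℕₚ.<? bound (x −ₚ y)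
  ... | yes n<N = x∙y⁻¹≈ε⇒x≈y _ _ (sumSq≈0 (bound (x −ₚ y)) eq n n<N)
  ... | no  n≮N = x∙y⁻¹≈ε⇒x≈y _ _ (vanish (x −ₚ y) n (ℕₚ.≮⇒≥ n≮N))

  ≈ₚ⇒dist²≈0 : ∀ {x y} → x ≈ₚ y → dist² x y ≈ 0#
  ≈ₚ⇒dist²≈0 {x} {y} x≈y =
    sumSq-zero (bound (x −ₚ y)) (λ n → trans (+-congʳ (x≈y n)) (-‿inverseʳ _))

  dist²⇒dist : ∀ {x y x′ y′} → dist² x y ≈ dist² x′ y′ → dist x y ≈ dist x′ y′
  dist²⇒dist {x} {y} {x′} {y′} = √-cong (‖ x −ₚ y ‖²-nonneg) (‖ x′ −ₚ y′ ‖²-nonneg)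

  dist⇒dist² : ∀ {x y x′ y′} → dist x y ≈ dist x′ y′ → dist² x y ≈ dist² x′ y′
  dist⇒dist² {x} {y} {x′} {y′} = √-injective (‖ x −ₚ y ‖²-nonneg) (‖ x′ −ₚ y′ ‖²-nonneg)

  dist²-split : ∀ z w → dist² z w ≈ dist² (evens z) (evens w) + dist² (odds z) (odds w)
  dist²-split z w = ‖‖²-split (z −ₚ w)

  -- The two sequences exchange roles at each step, giving f 0, g 0, f 1, g 1, and so on.
  interleave : (ℕ → Carrier) → (ℕ → Carrier) → ℕ → Carrier
  interleave f g zero    = f 0
  interleave f g (suc n) = interleave g (f ∘ suc) n

  interleave-even : ∀ f g n → interleave f g (2 ℕ.* n) ≡ f n
  interleave-even f g zero    = ≡.refl
  interleave-even f g (suc n) = ≡.trans (≡.cong (interleave f g) (ℕₚ.*-suc 2 n))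
                                  (interleave-even (f ∘ suc) (g ∘ suc) n)

  interleave-odd : ∀ f g n → interleave f g (suc (2 ℕ.* n)) ≡ g n
  interleave-odd f g n = interleave-even g (f ∘ suc) n

  interleave-vanish : ∀ b {f g} → (∀ n → b ℕ.≤ n → f n ≈ 0#) → (∀ n → b ℕ.≤ n → g n ≈ 0#) →
                      ∀ n → 2 ℕ.* b ℕ.≤ n → interleave f g n ≈ 0#
  interleave-vanish zero f≈0 g≈0 zero          _ = f≈0 0 ℕ.z≤n
  interleave-vanish zero f≈0 g≈0 (suc zero)    _ = g≈0 0 ℕ.z≤n
  interleave-vanish zero f≈0 g≈0 (suc (suc n)) _ =
    interleave-vanish zero (λ n _ → f≈0 (suc n) ℕ.z≤n) (λ n _ → g≈0 (suc n) ℕ.z≤n) n ℕ.z≤n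
  interleave-vanish (suc b) {f} {g} f≈0 g≈0 n 2b≤n
    with n | ≡.subst (ℕ._≤ n) (ℕₚ.*-suc 2 b) 2b≤n
  ... | suc (suc n) | ℕ.s≤s (ℕ.s≤s 2b≤n) = interleave-vanish b
    (λ n b≤n → f≈0 (suc n) (ℕ.s≤s b≤n)) (λ n b≤n → g≈0 (suc n) (ℕ.s≤s b≤n)) n 2b≤n

  join : Point → Point → Point
  join x y = record
    { coord  = interleave (coord x) (coord y)
    ; bound  = 2 ℕ.* (bound x ℕ.⊔ bound y)
    ; vanish = interleave-vanish (bound x ℕ.⊔ bound y)
        (λ n b≤n → vanish x n (ℕₚ.m⊔n≤o⇒m≤o (bound x) (bound y) b≤n))
        (λ n b≤n → vanish y n (ℕₚ.m⊔n≤o⇒n≤o (bound x) (bound y) b≤n))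
    }

  evens-join : ∀ x y → evens (join x y) ≈ₚ x
  evens-join x y n = reflexive (interleave-even (coord x) (coord y) n)

  odds-join : ∀ x y → odds (join x y) ≈ₚ y
  odds-join x y n = reflexive (interleave-odd (coord x) (coord y) n)

  interleave-cong : ∀ {f f′ g g′} → (∀ n → f n ≈ f′ n) → (∀ n → g n ≈ g′ n) →
                    ∀ n → interleave f g n ≈ interleave f′ g′ n
  interleave-cong f≈f′ g≈g′ zero    = f≈f′ 0
  interleave-cong f≈f′ g≈g′ (suc n) = interleave-cong g≈g′ (f≈f′ ∘ suc) n

  dist²-join : ∀ x y x′ y′ → dist² (join x y) (join x′ y′) ≈ dist² x x′ + dist² y y′
  dist²-join x y x′ y′ = trans (dist²-split (join x y) (join x′ y′)) (+-cong
    (dist²-cong {evens (join x y)} {x} {evens (join x′ y′)} {x′} (evens-join x y) (evens-join x′ y′))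
    (dist²-cong {odds (join x y)} {y} {odds (join x′ y′)} {y′} (odds-join x y) (odds-join x′ y′)))

  δ : ℕ → ℕ → Carrier
  δ zero    zero    = 1#
  δ zero    (suc n) = 0#
  δ (suc i) zero    = 0#
  δ (suc i) (suc n) = δ i n

  δ-≢ : ∀ {i n} → i ≢ n → δ i n ≈ 0#
  δ-≢ {zero}  {zero}  i≢n = contradiction ≡.refl i≢n
  δ-≢ {zero}  {suc n} i≢n = refl
  δ-≢ {suc i} {zero}  i≢n = refl
  δ-≢ {suc i} {suc n} i≢n = δ-≢ (i≢n ∘ ≡.cong suc)

  δ-vanish : ∀ i n → suc i ℕ.≤ n → δ i n ≈ 0#
  δ-vanish i n i<n = δ-≢ (ℕₚ.<⇒≢ i<n)

  sumSq-δ : ∀ N {i c g} → i ℕ.< N → g i ≈ 0# →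
            sumSq N (λ n → c * δ i n + g n) ≈ c * c + sumSq N g
  sumSq-δ (suc N) {zero} {c} {g} _ gi≈0 = begin
    (c * 1# + g 0) * (c * 1# + g 0) + sumSq N (λ n → c * 0# + g (suc n))
      ≈⟨ +-cong (*-cong head head) (sumSq-cong N {g = g ∘ suc} λ n → trans (+-congʳ (zeroʳ c)) (+-identityˡ _)) ⟩
    c * c + sumSq N (g ∘ suc)
      ≈⟨ +-congˡ (trans (+-congʳ (trans (*-congʳ gi≈0) (zeroˡ _))) (+-identityˡ _)) ⟨
    c * c + (g 0 * g 0 + sumSq N (g ∘ suc)) ∎
    where
    head : c * 1# + g 0 ≈ c
    head = trans (+-cong (*-identityʳ c) gi≈0) (+-identityʳ c)
  sumSq-δ (suc N) {suc i} {c} {g} (ℕ.s≤s i<N) gi≈0 = begin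
    (c * 0# + g 0) * (c * 0# + g 0) + sumSq N (λ n → c * δ i n + g (suc n))
      ≈⟨ +-cong (*-cong head head) (sumSq-δ N {g = g ∘ suc} i<N gi≈0) ⟩
    g 0 * g 0 + (c * c + sumSq N (g ∘ suc))
      ≈⟨ solve 3 (λ a b d → a :+ (b :+ d) := b :+ (a :+ d)) refl _ _ _ ⟩
    c * c + (g 0 * g 0 + sumSq N (g ∘ suc)) ∎
    where
    head : c * 0# + g 0 ≈ g 0
    head = trans (+-congʳ (zeroʳ c)) (+-identityˡ _)

  -- Differences of the vectors below are first collected into such a list with distinct indices;
  -- orthonormality of the basis then gives the squared norm as `normSq`.
  combination : List (Carrier × ℕ) → ℕ → Carrier
  combination []            n = 0#
  combination ((c , i) ∷ l) n = c * δ i n + combination l n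

  normSq : List (Carrier × ℕ) → Carrier
  normSq []            = 0#
  normSq ((c , i) ∷ l) = c * c + normSq l

  combination-≢ : ∀ {i} {l : List (Carrier × ℕ)} → All (λ t → i ≢ proj₂ t) l → combination l i ≈ 0#
  combination-≢ []          = refl
  combination-≢ (i≢ ∷ rest) =
    trans (+-cong (trans (*-congˡ (δ-≢ (≢-sym i≢))) (zeroʳ _)) (combination-≢ rest)) (+-identityʳ 0#)

  sumSq-combination : ∀ {N} {l : List (Carrier × ℕ)} → All (λ t → proj₂ t ℕ.< N) l →
                      AllPairs (λ s t → proj₂ s ≢ proj₂ t) l → sumSq N (combination l) ≈ normSq l
  sumSq-combination {N} [] [] = sumSq-zero N (λ _ → refl)
  sumSq-combination {N} {(c , i) ∷ l} (i<N ∷ l<N) (i∉l ∷ l!) =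
    trans (sumSq-δ N {g = combination l} i<N (combination-≢ {l = l} i∉l)) (+-congˡ (sumSq-combination l<N l!))

  τ : Carrier → Carrier → ℕ → ℕ → Point
  τ c c′ i j = record
    { coord  = λ n → c * δ i n + c′ * δ j n
    ; bound  = suc (i ℕ.⊔ j)
    ; vanish = λ n b≤n → trans
        (+-cong (*-congˡ (δ-vanish i n (ℕₚ.≤-trans (ℕ.s≤s (ℕₚ.m≤m⊔n i j)) b≤n)))
                (*-congˡ (δ-vanish j n (ℕₚ.≤-trans (ℕ.s≤s (ℕₚ.m≤n⊔m i j)) b≤n))))
        (solve 2 (λ c c′ → c :* con (+ 0) :+ c′ :* con (+ 0) := con (+ 0)) refl c c′)
    }

  dist²-combination : ∀ x y l {N} → bound x ℕ.≤ N → bound y ℕ.≤ N →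
    (∀ n → coord x n - coord y n ≈ combination l n) →
    All (λ t → proj₂ t ℕ.< N) l → AllPairs (λ s t → proj₂ s ≢ proj₂ t) l →
    dist² x y ≈ normSq l
  dist²-combination x y l {N} bx≤N by≤N eq l<N l! =
    trans (‖‖²≈sumSq (x −ₚ y) (ℕₚ.⊔-lub bx≤N by≤N)) (trans (sumSq-cong N eq) (sumSq-combination l<N l!))

  module _ (i j i′ j′ : ℕ) where
    private
      N : ℕ
      N = suc (i ℕ.⊔ j) ℕ.⊔ suc (i′ ℕ.⊔ j′)

      b≤ : suc (i ℕ.⊔ j) ℕ.≤ N
      b≤ = ℕₚ.m≤m⊔n (suc (i ℕ.⊔ j)) (suc (i′ ℕ.⊔ j′))

      b′≤ : suc (i′ ℕ.⊔ j′) ℕ.≤ N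
      b′≤ = ℕₚ.m≤n⊔m (suc (i ℕ.⊔ j)) (suc (i′ ℕ.⊔ j′))

      i< : i ℕ.< N
      i< = ℕₚ.≤-trans (ℕ.s≤s (ℕₚ.m≤m⊔n i j)) b≤

      j< : j ℕ.< N
      j< = ℕₚ.≤-trans (ℕ.s≤s (ℕₚ.m≤n⊔m i j)) b≤

      i′< : i′ ℕ.< N
      i′< = ℕₚ.≤-trans (ℕ.s≤s (ℕₚ.m≤m⊔n i′ j′)) b′≤

      j′< : j′ ℕ.< N
      j′< = ℕₚ.≤-trans (ℕ.s≤s (ℕₚ.m≤n⊔m i′ j′)) b′≤

    -- The difference is c eᵢ + (c′ - c) eⱼ - c′ eⱼ′. Only the shared index sees the relative sign
    -- of `c` and `c′`: it contributes 0 for equal and 4 c² for opposite coefficients.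
    dist²-τ-shift : ∀ {c c′} → i ≢ j → j ≡ i′ → i ≢ j′ → i′ ≢ j′ →
      dist² (τ c c′ i j) (τ c c′ i′ j′) ≈ c * c + ((c′ - c) * (c′ - c) + c′ * c′)
    dist²-τ-shift {c} {c′} i≢j ≡.refl i≢j′ i′≢j′ = trans
      (dist²-combination (τ c c′ i j) (τ c c′ i′ j′) ((c , i) ∷ (c′ - c , j) ∷ (- c′ , j′) ∷ []) b≤ b′≤
        (λ n → solve 5 (λ c c′ a b d → (c :* a :+ c′ :* b) :- (c :* b :+ c′ :* d)
             := c :* a :+ ((c′ :- c) :* b :+ ((:- c′) :* d :+ con (+ 0)))) refl c c′ (δ i n) (δ j n) (δ j′ n))
        (i< ∷ j< ∷ j′< ∷ []) ((i≢j ∷ i≢j′ ∷ []) ∷ (i′≢j′ ∷ []) ∷ [] ∷ []))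
      (solve 2 (λ c c′ → c :* c :+ ((c′ :- c) :* (c′ :- c) :+ ((:- c′) :* (:- c′) :+ con (+ 0)))
             := c :* c :+ ((c′ :- c) :* (c′ :- c) :+ c′ :* c′)) refl c c′)

    -- No index is first in one pair and second in the other, so each position either cancels or
    -- contributes two squares, and `m` counts the positions that differ. It is chosen before `c`
    -- and `c′` so that both halves of `σ` share it.
    dist²-τ : i ≢ j → i′ ≢ j′ → i ≢ j′ → i′ ≢ j → ∃ λ (m : Fin 3) → ∀ {c c′} → c * c ≈ c′ * c′ →
      dist² (τ c c′ i j) (τ c c′ i′ j′) ≈ toℕ m ×ℕ (c * c + c * c)
    dist²-τ i≢j i′≢j′ i≢j′ i′≢j with i ℕₚ.≟ i′ | j ℕₚ.≟ j′
    ... | yes ≡.refl | yes ≡.refl = 0F , λ {c} {c′} _ → ≈ₚ⇒dist²≈0 {τ c c′ i j} {τ c c′ i j} (λ n → refl)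
    ... | yes ≡.refl | no j≢j′ = 1F , λ {c} {c′} c²≈c′² → trans
      (dist²-combination (τ c c′ i j) (τ c c′ i′ j′) ((c′ , j) ∷ (- c′ , j′) ∷ []) b≤ b′≤
        (λ n → solve 5 (λ c c′ a b d → (c :* a :+ c′ :* b) :- (c :* a :+ c′ :* d)
             := c′ :* b :+ ((:- c′) :* d :+ con (+ 0))) refl c c′ (δ i n) (δ j n) (δ j′ n))
        (j< ∷ j′< ∷ []) ((j≢j′ ∷ []) ∷ [] ∷ []))
      (trans (solve 1 (λ c′ → c′ :* c′ :+ ((:- c′) :* (:- c′) :+ con (+ 0)) := c′ :* c′ :+ c′ :* c′ :+ con (+ 0)) refl c′)
        (+-congʳ (+-cong (sym c²≈c′²) (sym c²≈c′²))))
    ... | no i≢i′ | yes ≡.refl = 1F , λ {c} {c′} _ → trans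
      (dist²-combination (τ c c′ i j) (τ c c′ i′ j′) ((c , i) ∷ (- c , i′) ∷ []) b≤ b′≤
        (λ n → solve 5 (λ c c′ a b d → (c :* a :+ c′ :* b) :- (c :* d :+ c′ :* b)
             := c :* a :+ ((:- c) :* d :+ con (+ 0))) refl c c′ (δ i n) (δ j n) (δ i′ n))
        (i< ∷ i′< ∷ []) ((i≢i′ ∷ []) ∷ [] ∷ []))
      (solve 1 (λ c′ → c′ :* c′ :+ ((:- c′) :* (:- c′) :+ con (+ 0)) := c′ :* c′ :+ c′ :* c′ :+ con (+ 0)) refl c)
    ... | no i≢i′ | no j≢j′ = 2F , λ {c} {c′} c²≈c′² → trans
      (dist²-combination (τ c c′ i j) (τ c c′ i′ j′) ((c , i) ∷ (c′ , j) ∷ (- c , i′) ∷ (- c′ , j′) ∷ []) b≤ b′≤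
        (λ n → solve 6 (λ c c′ a b d e → (c :* a :+ c′ :* b) :- (c :* d :+ c′ :* e)
             := c :* a :+ (c′ :* b :+ ((:- c) :* d :+ ((:- c′) :* e :+ con (+ 0))))) refl
             c c′ (δ i n) (δ j n) (δ i′ n) (δ j′ n))
        (i< ∷ j< ∷ i′< ∷ j′< ∷ [])
        ((i≢j ∷ i≢i′ ∷ i≢j′ ∷ []) ∷ (≢-sym i′≢j ∷ j≢j′ ∷ []) ∷ (i′≢j′ ∷ []) ∷ [] ∷ []))
      (trans (solve 2 (λ c c′ → c :* c :+ (c′ :* c′ :+ ((:- c) :* (:- c) :+ ((:- c′) :* (:- c′) :+ con (+ 0))))
               := (c :* c :+ c′ :* c′) :+ ((c :* c :+ c′ :* c′) :+ con (+ 0))) refl c c′)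
        (+-cong (+-congˡ (sym c²≈c′²)) (+-congʳ (+-congˡ (sym c²≈c′²)))))

  -- p (eᵢ + eⱼ) ⊕ q (eᵢ − eⱼ)
  σ : Carrier → Carrier → ℕ → ℕ → Point
  σ p q i j = join (τ p p i j) (τ q (- q) i j)

  -- The first half contributes p² + 0 + p², the second q² + (2 q)² + q².
  dist²-σ-shift : ∀ {p q i j k} → i ℕ.< j → j ℕ.< k →
    dist² (σ p q i j) (σ p q j k) ≈ (p * p + p * p) + 6 ×ℕ (q * q)
  dist²-σ-shift {p} {q} {i} {j} {k} i<j j<k = trans
    (dist²-join (τ p p i j) (τ q (- q) i j) (τ p p j k) (τ q (- q) j k))
    (trans (+-cong (dist²-τ-shift i j j k {p} {p} (ℕₚ.<⇒≢ i<j) ≡.refl (ℕₚ.<⇒≢ i<k) (ℕₚ.<⇒≢ j<k))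
                   (dist²-τ-shift i j j k {q} { - q} (ℕₚ.<⇒≢ i<j) ≡.refl (ℕₚ.<⇒≢ i<k) (ℕₚ.<⇒≢ j<k)))
      (solve 2 (λ p q → (p :* p :+ ((p :- p) :* (p :- p) :+ p :* p))
                     :+ (q :* q :+ (((:- q) :- q) :* ((:- q) :- q) :+ (:- q) :* (:- q)))
             := (p :* p :+ p :* p) :+ (q :* q :+ (q :* q :+ (q :* q :+ (q :* q :+ (q :* q :+ (q :* q :+ con (+ 0))))))))
        refl p q))
    where i<k = ℕₚ.<-trans i<j j<k

  shiftGraph : Carrier → Carrier → Config
  shiftGraph p q = record
    { mem  = λ z → ∃ λ i → ∃ λ j → i ℕ.< j × z ≈ₚ σ p q i j
    ; resp = λ {x} {y} x≈y (i , j , i<j , eq) →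
        i , j , i<j , ≈ₚ-trans {y} {x} {σ p q i j} (≈ₚ-sym {x} {y} x≈y) eq
    }

  -- The unit `2 p² + 2 q²` falls short of the squared edge length by `4 q²`; this is the origin of
  -- the term 4 s.
  dist²-σ : ∀ p q {i j i′ j′} → i ℕ.< j → i′ ℕ.< j′ → i ≢ j′ → i′ ≢ j →
    ∃ λ (m : Fin 3) → dist² (σ p q i j) (σ p q i′ j′) ≈ toℕ m ×ℕ ((p * p + p * p) + (q * q + q * q))
  dist²-σ p q {i} {j} {i′} {j′} i<j i′<j′ i≢j′ i′≢j
    with m , eq ← dist²-τ i j i′ j′ (ℕₚ.<⇒≢ i<j) (ℕₚ.<⇒≢ i′<j′) i≢j′ i′≢j
    = m , trans (dist²-join (τ p p i j) (τ q (- q) i j) (τ p p i′ j′) (τ q (- q) i′ j′))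
        (trans (+-cong (eq refl) (eq (solve 1 (λ q → q :* q := (:- q) :* (:- q)) refl q)))
          (sym (×-distrib-+ (p * p + p * p) (q * q + q * q) (toℕ m))))

-- Avoiding countably many values of the free parameter.

module Genericity (em : ExcludedMiddle (lsuc 0ℓ)) (ℝ : CompleteOrderedField) where

  open CompleteOrderedField ℝ hiding (zero)
  open Combinatorics
  open Configurations ℝ
  open IntegerCoefficients ℝ
  open OrderedField em ℝ
  open Geometry em ℝ
  open import Algebra.Properties.CommutativeMonoid.Sum +-commutativeMonoid
    using (sum-syntax; sum-cong-≋; ∑-distrib-+)
  open import Algebra.Properties.CommutativeMonoid.Sum ℕₚ.+-0-commutativeMonoid
    using () renaming (sum to sumℕ)
  open import Algebra.Properties.Ring ring using (x∙y⁻¹≈ε⇒x≈y; +-cancelˡ; +-cancelʳ)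
  open import Algebra.Properties.Monoid.Mult +-monoid using (×-congʳ; ×-homo-+) renaming (_×_ to _×ℕ_)
  open import Algebra.Properties.CommutativeMonoid.Mult +-commutativeMonoid using (×-distrib-+)
  open import Relation.Binary.Reasoning.Setoid setoid

  record Interval : Set where
    constructor interval
    field
      lo hi : Carrier
      lo<hi : lo < hi
  open Interval

  midpoint : Interval → Carrier
  midpoint I = ½ * lo I + ½ * hi I

  private
    0<hi-lo : ∀ I → 0# < ½ * (hi I - lo I)
    0<hi-lo (interval l h (l≤h , l≉h)) =
      *-pos 0<½ (x≤y⇒0≤y-x l≤h , λ 0≈ → l≉h (sym (x∙y⁻¹≈ε⇒x≈y h l (sym 0≈))))

    0<y-x⇒x<y : ∀ {x y} → 0# < y - x → x < y
    0<y-x⇒x<y (0≤ , 0≉) = 0≤y-x⇒x≤y 0≤ , λ x≈y → 0≉ (sym (trans (+-congʳ (sym x≈y)) (-‿inverseʳ _)))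

    <-respʳ : ∀ {x y z} → y ≈ z → x < y → x < z
    <-respʳ y≈z (x≤y , x≉y) = ≤-respʳ y≈z x≤y , λ x≈z → x≉y (trans x≈z (sym y≈z))

  lo<midpoint : ∀ I → lo I < midpoint I
  lo<midpoint I = 0<y-x⇒x<y (<-respʳ (trans
    (solve 3 (λ h l u → h :* (u :- l) := h :* l :+ h :* u :- (h :* l :+ h :* l)) refl ½ (lo I) (hi I))
    (+-congˡ (-‿cong (½x+½x≈x (lo I))))) (0<hi-lo I))

  midpoint<hi : ∀ I → midpoint I < hi I
  midpoint<hi I = 0<y-x⇒x<y (<-respʳ (trans
    (solve 3 (λ h l u → h :* (u :- l) := (h :* u :+ h :* u) :- (h :* l :+ h :* u)) refl ½ (lo I) (hi I))
    (+-congʳ (½x+½x≈x (hi I)))) (0<hi-lo I))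

  module _ {I : Set} (code : I → ℕ) (R : I → Carrier → Set)
           (functional : ∀ {i j x y} → code i ≡ code j → R i x → R j y → x ≈ y) where

    Avoids : Interval → ℕ → Set
    Avoids J n = ∀ i x → code i ≡ n → R i x → ¬ (lo J ≤ x × x ≤ hi J)

    -- By `functional`, code `n` excludes at most one value. If that value is at most the midpoint,
    -- an interval strictly to the right of the midpoint is safe; otherwise the left half is.
    shrink : ∀ J n → ∃ λ K → lo J ≤ lo K × hi K ≤ hi J × Avoids K n
    shrink J n with lem (∃₂ λ i x → code i ≡ n × R i x × x ≤ midpoint J)
    ... | yes (i , x , ci≡n , Rix , x≤m) =
        K , ≤-trans (proj₁ (lo<midpoint J)) (proj₁ (lo<midpoint right)) , ≤-refl , avoids
      where
      right K : Interval
      right = interval (midpoint J) (hi J) (midpoint<hi J)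
      -- The closed right half still contains the midpoint, which may be the excluded value; hence
      -- its own upper half.
      K     = interval (midpoint right) (hi J) (midpoint<hi right)
      avoids : Avoids K n
      avoids j y cj≡n Rjy (m′≤y , _) = proj₂ (lo<midpoint right) (antisym (proj₁ (lo<midpoint right))
        (≤-trans m′≤y (≤-respˡ (functional (≡.trans ci≡n (≡.sym cj≡n)) Rix Rjy) x≤m)))
    ... | no none = interval (lo J) (midpoint J) (lo<midpoint J) , ≤-refl , proj₁ (midpoint<hi J) ,
        λ i x ci≡n Rix (_ , x≤m) → none (i , x , ci≡n , Rix , x≤m)

    nest : Interval → ℕ → Interval
    nest J zero    = J
    nest J (suc n) = proj₁ (shrink (nest J n) n)

    lo-mono : ∀ J {m n} → m ℕ.≤′ n → lo (nest J m) ≤ lo (nest J n)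
    lo-mono J ℕ.≤′-refl = ≤-refl
    lo-mono J {n = suc n} (ℕ.≤′-step m≤n) =
      ≤-trans (lo-mono J m≤n) (proj₁ (proj₂ (shrink (nest J n) n)))

    hi-mono : ∀ J {m n} → m ℕ.≤′ n → hi (nest J n) ≤ hi (nest J m)
    hi-mono J ℕ.≤′-refl = ≤-refl
    hi-mono J {n = suc n} (ℕ.≤′-step m≤n) =
      ≤-trans (proj₁ (proj₂ (proj₂ (shrink (nest J n) n)))) (hi-mono J m≤n)

    lo≤hi : ∀ J m n → lo (nest J m) ≤ hi (nest J n)
    lo≤hi J m n with ℕₚ.≤-total m n
    ... | inj₁ m≤n = ≤-trans (lo-mono J (ℕₚ.≤⇒≤′ m≤n)) (proj₁ (lo<hi (nest J n)))
    ... | inj₂ n≤m = ≤-trans (proj₁ (lo<hi (nest J m))) (hi-mono J (ℕₚ.≤⇒≤′ n≤m))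

    -- Cantor's nested intervals: the supremum of the left ends lies in all of them. The values
    -- excluded by code `n` are absent from interval `suc n`.
    avoid-countable : ∀ J → ∃ λ s → lo J ≤ s × s ≤ hi J × (∀ i → ¬ R i s)
    avoid-countable J with supremum (λ x → ∃ λ n → x ≈ lo (nest J n)) (lo J , 0 , refl)
                             (hi J , λ { x (n , eq) → ≤-respˡ (sym eq) (lo≤hi J n 0) })
    ... | s , upper , least = s , upper (lo J) (0 , refl) , s≤hi 0 , λ i Ris →
        proj₂ (proj₂ (proj₂ (shrink (nest J (code i)) (code i)))) i s ≡.refl Ris
          (upper _ (suc (code i) , refl) , s≤hi (suc (code i)))
      where
      s≤hi : ∀ n → s ≤ hi (nest J n)
      s≤hi n = least _ λ { x (m , eq) → ≤-respˡ (sym eq) (lo≤hi J m n) }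

  infix 8 _·_
  _·_ : ∀ {d} → (Fin d → Fin 3) → (Fin d → Carrier) → Carrier
  _·_ {d} m x = ∑[ k < d ] (toℕ (m k) ×ℕ x k)

  mass : ∀ {d} → (Fin d → Fin 3) → ℕ
  mass m = sumℕ (toℕ ∘ m)

  ·-cong : ∀ {d} (m : Fin d → Fin 3) {x y} → (∀ k → x k ≈ y k) → m · x ≈ m · y
  ·-cong m x≈y = sum-cong-≋ (λ k → ×-congʳ (toℕ (m k)) (x≈y k))

  ·-congˡ : ∀ {d} {m m′ : Fin d → Fin 3} x → (∀ k → m k ≡ m′ k) → m · x ≈ m′ · x
  ·-congˡ x m≗m′ = sum-cong-≋ (λ k → reflexive (≡.cong (λ i → toℕ i ×ℕ x k) (m≗m′ k)))

  -- Shows the dependence on `y` to be affine with slope `- mass m`.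
  ·-shift : ∀ {d} (m : Fin d → Fin 3) b y → m · (λ k → b k - y) + mass m ×ℕ y ≈ m · b
  ·-shift {d} m b y = trans (+-congˡ (mass-× m)) (trans
    (sym (∑-distrib-+ (λ k → toℕ (m k) ×ℕ (b k - y)) (λ k → toℕ (m k) ×ℕ y)))
    (sum-cong-≋ (λ k → trans (sym (×-distrib-+ (b k - y) y (toℕ (m k))))
      (×-congʳ (toℕ (m k)) (solve 2 (λ b y → b :- y :+ y := b) refl (b k) y)))))
    where
    mass-× : ∀ {d} (m : Fin d → Fin 3) → mass m ×ℕ y ≈ m · (λ _ → y)
    mass-× {zero}  m = refl
    mass-× {suc d} m = trans (×-homo-+ y (toℕ (m 0F)) _) (+-congˡ (mass-× (m ∘ Fin.suc)))

  ·-massless : ∀ {d} (m : Fin d → Fin 3) x → mass m ≡ 0 → m · x ≈ 0#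
  ·-massless {zero}  m x _ = refl
  ·-massless {suc d} m x mass≡0 = trans (+-cong
      (reflexive (≡.cong (_×ℕ x 0F) (ℕₚ.m+n≡0⇒m≡0 (toℕ (m 0F)) mass≡0)))
      (·-massless (m ∘ Fin.suc) (x ∘ Fin.suc) (ℕₚ.m+n≡0⇒n≡0 (toℕ (m 0F)) mass≡0)))
    (+-identityʳ 0#)

  -- For `s ≤ ε` the quantity `b k - 6 s` stays nonnegative, so that a real `p` with
  -- `2 p² + 6 s = b k` exists.
  common-sixth : ∀ {d} (b : Fin d → Carrier) → (∀ k → 0# < b k) →
                 ∃ λ ε → 0# < ε × (∀ k → 6 ×ℕ ε ≤ b k)
  common-sixth {zero}  b 0<b = 1# , 0<1 , λ ()
  common-sixth {suc d} b 0<b with common-sixth (b ∘ Fin.suc) (0<b ∘ Fin.suc)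
  ... | ε , 0<ε , 6ε≤b = smaller (total ε η)
    where
    η : Carrier
    -- An eighth, because repeated halving suffices: `6 η ≤ 8 η = b 0F`.
    η = ½ * (½ * (½ * b 0F))
    0<η : 0# < η
    0<η = *-pos 0<½ (*-pos 0<½ (*-pos 0<½ (0<b 0F)))
    8η≈b : 8 ×ℕ η ≈ b 0F
    8η≈b = begin
      8 ×ℕ η                                            ≈⟨ solve 1 (λ e → e :+ (e :+ (e :+ (e :+ (e :+ (e :+ (e :+ (e :+ con (+ 0))))))))
                                                            := ((e :+ e) :+ (e :+ e)) :+ ((e :+ e) :+ (e :+ e))) refl η ⟩
      ((η + η) + (η + η)) + ((η + η) + (η + η))         ≈⟨ +-cong (+-cong (½x+½x≈x _) (½x+½x≈x _)) (+-cong (½x+½x≈x _) (½x+½x≈x _)) ⟩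
      (½ * (½ * b 0F) + ½ * (½ * b 0F)) + (½ * (½ * b 0F) + ½ * (½ * b 0F))
                                                        ≈⟨ +-cong (½x+½x≈x _) (½x+½x≈x _) ⟩
      ½ * b 0F + ½ * b 0F                               ≈⟨ ½x+½x≈x _ ⟩
      b 0F                                              ∎
    6η≤b : 6 ×ℕ η ≤ b 0F
    6η≤b = ≤-respʳ 8η≈b (×ℕ-monoˡ-≤ (proj₁ 0<η) (ℕₚ.m≤m+n 6 2))
    smaller : ε ≤ η ⊎ η ≤ ε → ∃ λ ε → 0# < ε × (∀ k → 6 ×ℕ ε ≤ b k)
    smaller (inj₁ ε≤η) = ε , 0<ε , λ where
      0F          → ≤-trans (×ℕ-monoʳ-≤ 6 ε≤η) 6η≤b
      (Fin.suc k) → 6ε≤b k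
    smaller (inj₂ η≤ε) = η , 0<η , λ where
      0F          → 6η≤b
      (Fin.suc k) → ≤-trans (×ℕ-monoʳ-≤ 6 η≤ε) (6ε≤b k)

  module _ {Y : Config} (countable : IsCountable Y) {n} (D : Fin n → Fin n → Carrier)
           {d} (b : Fin d → Carrier) (0<b : ∀ k → 0# < b k) where

    private
      module ι = Injection countable

      Index : Set
      Index = Fin n × Fin n × Σ Point (_∈ Y) × Σ Point (_∈ Y) × (Fin d → Fin 3)

      code : Index → ℕ
      code (i , j , y , y′ , m) =
        pair (toℕ i) (pair (toℕ j) (pair (ι.to y) (pair (ι.to y′) (toℕ (funToFin m)))))

      Bad : Index → Carrier → Set
      Bad (i , j , y , y′ , m) s =
        mass m ≢ 0 × m · (λ k → b k - 4 ×ℕ s) + dist² (proj₁ y) (proj₁ y′) ≈ D i j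

      -- Equal codes give points of `Y` equal up to `≈ₚ` and multiplicities equal pointwise, which
      -- is enough: `s` and `s′` then solve the same affine equation of slope `- 4 (mass m)`, which
      -- is nonzero.
      functional : ∀ {t t′ s s′} → code t ≡ code t′ → Bad t s → Bad t′ s′ → s ≈ s′
      functional {i , j , y , y′ , m} {i₁ , j₁ , y₁ , y₁′ , m₁} {s} {s′} eq (mass≢0 , bad) (_ , bad₁)
        with i≡ , eq ← pair-injective {toℕ i} eq
        with j≡ , eq ← pair-injective {toℕ j} eq
        with y≡ , eq ← pair-injective {ι.to y} eq
        with y′≡ , m≡ ← pair-injective {ι.to y′} eq
        with ≡.refl ← Finₚ.toℕ-injective i≡
        with ≡.refl ← Finₚ.toℕ-injective j≡ = conclude (mass m) ≡.refl mass≢0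
        where
        m≗m₁ : ∀ k → m k ≡ m₁ k
        m≗m₁ k = ≡.trans (≡.sym (Finₚ.finToFun-funToFin m k))
          (≡.trans (≡.cong (λ c → finToFun c k) (Finₚ.toℕ-injective m≡)) (Finₚ.finToFun-funToFin m₁ k))

        dist²≈ : dist² (proj₁ y₁) (proj₁ y₁′) ≈ dist² (proj₁ y) (proj₁ y′)
        dist²≈ = dist²-cong {proj₁ y₁} {proj₁ y} {proj₁ y₁′} {proj₁ y′}
          (ι.injective (≡.sym y≡)) (ι.injective (≡.sym y′≡))

        ·≈ : m · (λ k → b k - 4 ×ℕ s) ≈ m · (λ k → b k - 4 ×ℕ s′)
        ·≈ = +-cancelʳ _ _ _ (trans bad (trans (sym bad₁)
          (+-cong (·-congˡ _ (λ k → ≡.sym (m≗m₁ k))) dist²≈)))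

        mass×≈ : mass m ×ℕ (4 ×ℕ s) ≈ mass m ×ℕ (4 ×ℕ s′)
        mass×≈ = +-cancelˡ _ _ _ (trans (·-shift m b (4 ×ℕ s)) (trans (sym (·-shift m b (4 ×ℕ s′)))
          (+-congʳ (sym ·≈))))

        conclude : ∀ M → mass m ≡ M → M ≢ 0 → s ≈ s′
        conclude zero    _      M≢0 = contradiction ≡.refl M≢0
        -- `×ℕ-cancel-≈ n` cancels the factor `suc n`: first the mass, then 4.
        conclude (suc M) mass≡M _   = ×ℕ-cancel-≈ 3 (×ℕ-cancel-≈ M
          (≡.subst (λ M → M ×ℕ (4 ×ℕ s) ≈ M ×ℕ (4 ×ℕ s′)) mass≡M mass×≈))

    generic : ∃ λ s → 0# ≤ s × (∀ k → 6 ×ℕ s ≤ b k) ×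
      (∀ i j (y y′ : Σ Point (_∈ Y)) m →
         m · (λ k → b k - 4 ×ℕ s) + dist² (proj₁ y) (proj₁ y′) ≈ D i j →
         m · (λ k → b k - 4 ×ℕ s) ≈ 0#)
    generic with common-sixth b 0<b
    ... | ε , 0<ε , 6ε≤b with avoid-countable code Bad (λ {t} {t′} → functional {t} {t′}) (interval 0# ε 0<ε)
    ... | s , 0≤s , s≤ε , good = s , 0≤s , (λ k → ≤-trans (×ℕ-monoʳ-≤ 6 s≤ε) (6ε≤b k)) , vanishing
      where
      vanishing : ∀ i j (y y′ : Σ Point (_∈ Y)) m →
         m · (λ k → b k - 4 ×ℕ s) + dist² (proj₁ y) (proj₁ y′) ≈ D i j →
         m · (λ k → b k - 4 ×ℕ s) ≈ 0#
      vanishing i j y y′ m eq with mass m ℕₚ.≟ 0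
      ... | yes mass≡0 = ·-massless m _ mass≡0
      ... | no  mass≢0 = contradiction (mass≢0 , eq) (good (i , j , y , y′ , m))

-- Indexed copies, the product argument, and towers of shift graphs.

module Families (em : ExcludedMiddle (lsuc 0ℓ)) (ℝ : CompleteOrderedField) where

  open CompleteOrderedField ℝ hiding (zero)
  open Combinatorics
  open Configurations ℝ
  open IntegerCoefficients ℝ
  open OrderedField em ℝ
  open Geometry em ℝ
  open Genericity em ℝ
  open import Algebra.Properties.CommutativeMonoid.Sum +-commutativeMonoid
    using (sum-syntax; sum-cong-≋)
  open import Algebra.Properties.Monoid.Mult +-monoid using () renaming (_×_ to _×ℕ_)
  open import Relation.Binary.Reasoning.Setoid setoid

  Matrix : ℕ → Set
  Matrix n = Fin n → Fin n → Carrier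

  -- Repetitions are allowed: the projection of F to Y need not be injective.
  Copy : ∀ {n} → Config → Matrix n → Set
  Copy {n} A D = ∃ λ (p : Fin n → Σ Point (_∈ A)) →
    ∀ i j → dist² (proj₁ (p i)) (proj₁ (p j)) ≈ D i j

  hasSize : ∀ A {m} (r : Fin m → Σ Point (_∈ A)) →
            (∀ {a b} → proj₁ (r a) ≈ₚ proj₁ (r b) → a ≡ b) →
            (∀ x → x ∈ A → ∃ λ a → proj₁ (r a) ≈ₚ x) → HasSize A m
  hasSize A r r-inj r-cover = record
    { to        = r
    ; cong      = λ { ≡.refl → λ n → refl }
    ; bijective = r-inj , λ (x , x∈A) → proj₁ (r-cover x x∈A) , λ { ≡.refl → proj₂ (r-cover x x∈A) }
    }

  image : ∀ {n} → (Fin n → Point) → Config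
  image p = record
    { mem  = λ x → ∃ λ i → x ≈ₚ p i
    ; resp = λ {x} {y} x≈y (i , x≈pi) → i , ≈ₚ-trans {y} {x} {p i} (≈ₚ-sym {x} {y} x≈y) x≈pi
    }

  representatives : ∀ {n} (p : Fin n → Point) → ∃₂ λ m (φ : Fin m → Fin n) →
    (∀ {a b} → p (φ a) ≈ₚ p (φ b) → a ≡ b) × (∀ i → ∃ λ a → p (φ a) ≈ₚ p i)
  representatives {zero}  p = 0 , id , (λ { {()} }) , λ ()
  representatives {suc n} p with representatives (p ∘ Fin.suc)
  ... | m , φ , φ-inj , φ-cover with lem (∃ λ a → p (Fin.suc (φ a)) ≈ₚ p 0F)
  ... | yes (a , eq) = m , Fin.suc ∘ φ , φ-inj , λ where
      0F          → a , eq
      (Fin.suc i) → φ-cover i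
  ... | no new = suc m , φ′ , (λ {a} {b} → φ′-inj a b) , λ where
      0F          → 0F , ≈ₚ-refl {p 0F}
      (Fin.suc i) → Fin.suc (proj₁ (φ-cover i)) , proj₂ (φ-cover i)
    where
    φ′ : Fin (suc m) → Fin (suc n)
    φ′ 0F          = 0F
    φ′ (Fin.suc a) = Fin.suc (φ a)
    φ′-inj : ∀ a b → p (φ′ a) ≈ₚ p (φ′ b) → a ≡ b
    φ′-inj 0F          0F          eq = ≡.refl
    φ′-inj 0F          (Fin.suc b) eq = contradiction (b , ≈ₚ-sym {p 0F} {p (φ′ (Fin.suc b))} eq) new
    φ′-inj (Fin.suc a) 0F          eq = contradiction (a , eq) new
    φ′-inj (Fin.suc a) (Fin.suc b) eq = ≡.cong Fin.suc (φ-inj eq)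

  image-finite : ∀ {n} (p : Fin n → Point) → IsFinite (image p)
  image-finite p with representatives p
  ... | m , φ , φ-inj , φ-cover = m , hasSize (image p) (λ a → p (φ a) , φ a , ≈ₚ-refl {p (φ a)}) φ-inj
    λ x (i , x≈pi) → proj₁ (φ-cover i) ,
      ≈ₚ-trans {p (φ (proj₁ (φ-cover i)))} {p i} {x} (proj₂ (φ-cover i)) (≈ₚ-sym {x} {p i} x≈pi)

  distances : ∀ A {n} → HasSize A n → Matrix n
  distances A h i j = dist² (proj₁ (Bijection.to h i)) (proj₁ (Bijection.to h j))

  -- Injectivity of `p` on the indices follows from the distances, since distinct points of `A` are
  -- at nonzero distance.
  ≅-image : ∀ A {n} (h : HasSize A n) (p : Fin n → Point) →
            (∀ i j → dist² (p i) (p j) ≈ distances A h i j) → A ≅ image p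
  ≅-image A h p dist-p = record
    { to        = λ x → p (index x) , index x , ≈ₚ-refl {p (index x)}
    ; cong      = λ {x} {y} x≈y n → reflexive (≡.cong (λ i → coord (p i) n) (index-cong x y x≈y))
    ; bijective = (λ {x} {y} → to-injective x y) , λ (y , i , y≈pi) → h.to i , λ {z} z≈hi →
        ≈ₚ-trans {p (index z)} {p i} {y} (λ n → reflexive (≡.cong (λ i → coord (p i) n) (index-unique z i z≈hi)))
          (≈ₚ-sym {y} {p i} y≈pi)
    } , λ x y → dist²⇒dist {p (index x)} {p (index y)} {proj₁ x} {proj₁ y}
          (trans (dist-p (index x) (index y))
            (dist²-cong {hp (index x)} {proj₁ x} {hp (index y)} {proj₁ y} (h-index x) (h-index y)))
    where
    module h = Bijection h

    hp : Fin _ → Point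
    hp i = proj₁ (h.to i)

    index : Σ Point (_∈ A) → Fin _
    index x = proj₁ (h.surjective x)

    h-index : ∀ x → hp (index x) ≈ₚ proj₁ x
    h-index x = proj₂ (h.surjective x) ≡.refl

    index-unique : ∀ x i → proj₁ x ≈ₚ hp i → index x ≡ i
    index-unique x i x≈hi = h.injective (≈ₚ-trans {hp (index x)} {proj₁ x} {hp i} (h-index x) x≈hi)

    index-cong : ∀ x y → proj₁ x ≈ₚ proj₁ y → index x ≡ index y
    index-cong x y x≈y = index-unique x (index y)
      (≈ₚ-trans {proj₁ x} {proj₁ y} {hp (index y)} x≈y (≈ₚ-sym {hp (index y)} {proj₁ y} (h-index y)))

    to-injective : ∀ x y → p (index x) ≈ₚ p (index y) → proj₁ x ≈ₚ proj₁ y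
    to-injective x y eq = ≈ₚ-trans {proj₁ x} {hp (index x)} {proj₁ y}
      (≈ₚ-sym {hp (index x)} {proj₁ x} (h-index x))
      (≈ₚ-trans {hp (index x)} {hp (index y)} {proj₁ y}
        (dist²≈0⇒≈ₚ {hp (index x)} {hp (index y)}
          (trans (sym (dist-p (index x) (index y))) (≈ₚ⇒dist²≈0 {p (index x)} {p (index y)} eq)))
        (h-index y))

  ≅⇒dist² : ∀ {A B} ((g , _) : A ≅ B) x y →
            dist² (proj₁ (Bijection.to g x)) (proj₁ (Bijection.to g y)) ≈ dist² (proj₁ x) (proj₁ y)
  ≅⇒dist² (g , isometry) x y =
    dist⇒dist² {proj₁ (Bijection.to g x)} {proj₁ (Bijection.to g y)} {proj₁ x} {proj₁ y} (isometry x y)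

  ≅-refl : ∀ A → A ≅ A
  ≅-refl A = Identity.bijection (points A) , λ x y → refl

  image⊆ : ∀ A {n} (p : Fin n → Σ Point (_∈ A)) → image (proj₁ ∘ p) ⊆ A
  image⊆ A p x (i , x≈pi) = resp A (≈ₚ-sym {x} {proj₁ (p i)} x≈pi) (proj₂ (p i))

  contains⇒copy : ∀ A X {n} (h : HasSize X n) → A ContainsCopyOf X → Copy A (distances X h)
  contains⇒copy A X h (A′ , A′⊆A , X≅A′@(g , _)) =
    (λ i → proj₁ (Bijection.to g (Bijection.to h i)) , A′⊆A _ (proj₂ (Bijection.to g (Bijection.to h i)))) ,
    λ i j → ≅⇒dist² {X} {A′} X≅A′ (Bijection.to h i) (Bijection.to h j)

  copy⇒contains : ∀ A X {n} (h : HasSize X n) → Copy A (distances X h) → A ContainsCopyOf X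
  copy⇒contains A X h (p , dist-p) =
    image (proj₁ ∘ p) , image⊆ A p , ≅-image X h (proj₁ ∘ p) dist-p

  -- A distance matrix in place of a target configuration lets the product argument simply add one
  -- matrix per axis.
  Ramsey : ∀ {n} → Config → Matrix n → Set
  Ramsey A D = ∀ r → r ≥ 1 → (χ : Coloring A r) →
    ∃ λ ((p , _) : Copy A D) → ∃ λ c → ∀ i → Func.to χ (p i) ≡ c

  Ramsey-resp : ∀ {A n} {D D′ : Matrix n} → (∀ i j → D i j ≈ D′ i j) → Ramsey A D → Ramsey A D′
  Ramsey-resp D≈D′ ramsey r r≥1 χ with ramsey r r≥1 χ
  ... | (p , dist-p) , mono = (p , λ i j → trans (dist-p i j) (D≈D′ i j)) , mono

  Ramsey⇒⟶ : ∀ W X {n} (h : HasSize X n) → Ramsey W (distances X h) → ∀ r → r ≥ 1 → W ⟶ X [ r ]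
  Ramsey⇒⟶ W X h ramsey r r≥1 χ with ramsey r r≥1 χ
  ... | (p , dist-p) , c , mono = image (proj₁ ∘ p) , image⊆ W p , ≅-image X h (proj₁ ∘ p) dist-p ,
        c , λ { x x∈W (i , x≈pi) → ≡.trans (Func.cong χ x≈pi) (mono i) }

  -- Robustness applies to the finite set of values of `y`; composing the isometry it yields with
  -- `y` restores the repetitions.
  robust⇒Ramsey : ∀ Y {n} → IsRobust Y → (y : Fin n → Σ Point (_∈ Y)) →
                  Ramsey Y (λ i j → dist² (proj₁ (y i)) (proj₁ (y j)))
  robust⇒Ramsey Y (_ , robust) y r r≥1 χ
    with robust C (image-finite (proj₁ ∘ y)) (C , image⊆ Y y , ≅-refl C) r r≥1 χ
    where
    C : Config
    C = image (proj₁ ∘ y)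
  ... | M , M⊆Y , C≅M@(g , _) , c , mono =
      ((λ i → proj₁ (M-point i) , M⊆Y _ (proj₂ (M-point i))) ,
       λ i j → ≅⇒dist² {image (proj₁ ∘ y)} {M} C≅M (C-point i) (C-point j)) ,
      c , λ i → mono _ _ (proj₂ (M-point i))
    where
    C-point : ∀ i → Σ Point (_∈ image (proj₁ ∘ y))
    C-point i = proj₁ (y i) , i , ≈ₚ-refl {proj₁ (y i)}
    M-point : ∀ i → Σ Point (_∈ M)
    M-point i = Bijection.to g (C-point i)

  -- The squared distance between two labelled ends of an edge of squared length `x`.
  mismatch : Bool → Bool → Carrier → Carrier
  mismatch true  true  x = 0#
  mismatch false false x = 0#
  mismatch true  false x = x
  mismatch false true  x = x

  join∈⊗ : ∀ {A B x y} → x ∈ A → y ∈ B → join x y ∈ A ⊗ B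
  join∈⊗ {A} {B} {x} {y} x∈A y∈B =
    resp A (≈ₚ-sym {evens (join x y)} {x} (evens-join x y)) x∈A ,
    resp B (≈ₚ-sym {odds (join x y)} {y} (odds-join x y)) y∈B

  -- Colouring each point of V by the colours of its translates by a finite part of
  -- the shift graph reduces the claim to V and to the shift graph alone.
  Ramsey-shiftGraph : ∀ {V n} {D : Matrix n} {p q b} (β : Fin n → Bool) →
    (p * p + p * p) + 6 ×ℕ (q * q) ≈ b → Ramsey V D →
    Ramsey (shiftGraph p q ⊗ V) (λ i j → mismatch (β i) (β j) b + D i j)
  Ramsey-shiftGraph {V} {n} {D} {p} {q} {b} β edge ramsey r r≥1 χ
    with shiftGraph-monochromatic r
  ... | N , same-colour =
    conclude (ramsey (r ℕ.^ (N ℕ.* N)) (ℕₚ.m^n>0 r {{ℕ.>-nonZero r≥1}} (N ℕ.* N)) χ′)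
    where
    pairPoint : Fin N → Fin N → Point
    pairPoint i k = σ p q (toℕ i) (suc (toℕ i ℕ.+ toℕ k))

    joined : Fin N → Fin N → Σ Point (_∈ V) → Σ Point (_∈ shiftGraph p q ⊗ V)
    joined i k (v , v∈V) = join (pairPoint i k) v , join∈⊗ {shiftGraph p q} {V} {pairPoint i k} {v}
      (toℕ i , suc (toℕ i ℕ.+ toℕ k) , ℕ.s≤s (ℕₚ.m≤m+n (toℕ i) (toℕ k)) , ≈ₚ-refl {pairPoint i k}) v∈V

    colours : Σ Point (_∈ V) → Fin (N ℕ.* N) → Fin r
    colours v t = Func.to χ (uncurry joined (remQuot N t) v)

    colours-cong : ∀ v w → proj₁ v ≈ₚ proj₁ w → ∀ t → colours v t ≡ colours w t
    colours-cong v w v≈w t = Func.cong χ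
      {uncurry joined (remQuot N t) v} {uncurry joined (remQuot N t) w}
      (interleave-cong {f = coord (uncurry pairPoint (remQuot {N} N t))} {g = coord (proj₁ v)} {coord (proj₁ w)}
        (λ n → refl) v≈w)

    χ′ : Coloring V (r ℕ.^ (N ℕ.* N))
    χ′ = record
      { to   = funToFin ∘ colours
      ; cong = λ {v} {w} v≈w → funToFin-cong {N ℕ.* N} {r} {colours v} {colours w} (colours-cong v w v≈w)
      }

    conclude : (∃ λ ((v , _) : Copy V D) → ∃ λ c → ∀ t → Func.to χ′ (v t) ≡ c) →
      ∃ λ ((z , _) : Copy (shiftGraph p q ⊗ V) (λ i j → mismatch (β i) (β j) b + D i j)) →
        ∃ λ c → ∀ t → Func.to χ (z t) ≡ c
    conclude ((v , dist-v) , c , mono)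
      -- All points of the copy in `V` carry the same table `c` of colours, so one monochromatic
      -- edge found in `c` serves them all.
      with i , k , j , l , j≡i+1+k , same ← same-colour (λ i k → finToFun c (combine i k)) =
      (z , dist-z) , finToFun c (combine i k) , λ t → mono-z (β t) (v t) (mono t)
      where
      end : Bool → Point
      end true  = pairPoint i k
      end false = pairPoint j l

      dist-edge : dist² (pairPoint i k) (pairPoint j l) ≈ b
      dist-edge = trans
        (≡.subst (λ x → dist² (σ p q (toℕ i) x) (pairPoint j l) ≈ (p * p + p * p) + 6 ×ℕ (q * q)) j≡i+1+k
          (dist²-σ-shift {p} {q} (≡.subst (toℕ i ℕ.<_) (≡.sym j≡i+1+k) (ℕ.s≤s (ℕₚ.m≤m+n (toℕ i) (toℕ k))))
            (ℕ.s≤s (ℕₚ.m≤m+n (toℕ j) (toℕ l)))))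
        edge

      dist-end : ∀ x y → dist² (end x) (end y) ≈ mismatch x y b
      dist-end true  true  = ≈ₚ⇒dist²≈0 {end true} {end true} (≈ₚ-refl {end true})
      dist-end false false = ≈ₚ⇒dist²≈0 {end false} {end false} (≈ₚ-refl {end false})
      dist-end true  false = dist-edge
      dist-end false true  = trans (dist²-sym (end false) (end true)) dist-edge

      place : Bool → Σ Point (_∈ V) → Σ Point (_∈ shiftGraph p q ⊗ V)
      place true  = joined i k
      place false = joined j l

      place-join : ∀ x v → proj₁ (place x v) ≡ join (end x) (proj₁ v)
      place-join true  v = ≡.refl
      place-join false v = ≡.refl

      z : Fin n → Σ Point (_∈ shiftGraph p q ⊗ V)
      z t = place (β t) (v t)

      dist-z : ∀ s t → dist² (proj₁ (z s)) (proj₁ (z t)) ≈ mismatch (β s) (β t) b + D s t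
      dist-z s t = begin
        dist² (proj₁ (z s)) (proj₁ (z t))
          ≡⟨ ≡.cong₂ dist² (place-join (β s) (v s)) (place-join (β t) (v t)) ⟩
        dist² (join (end (β s)) (proj₁ (v s))) (join (end (β t)) (proj₁ (v t)))
          ≈⟨ dist²-join (end (β s)) (proj₁ (v s)) (end (β t)) (proj₁ (v t)) ⟩
        dist² (end (β s)) (end (β t)) + dist² (proj₁ (v s)) (proj₁ (v t))
          ≈⟨ +-cong (dist-end (β s) (β t)) (dist-v s t) ⟩
        mismatch (β s) (β t) b + D s t ∎

      colour-joined : ∀ i k v → Func.to χ′ v ≡ c → Func.to χ (joined i k v) ≡ finToFun c (combine i k)
      colour-joined i k v ≡c = ≡.trans
        (≡.cong (λ t → Func.to χ (uncurry joined t v)) (≡.sym (Finₚ.remQuot-combine i k)))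
        (≡.trans (≡.sym (Finₚ.finToFun-funToFin (colours v) (combine i k)))
          (≡.cong (λ c → finToFun c (combine i k)) ≡c))

      mono-z : ∀ x v → Func.to χ′ v ≡ c → Func.to χ (place x v) ≡ finToFun c (combine i k)
      mono-z true  v ≡c = colour-joined i k v ≡c
      mono-z false v ≡c = ≡.trans (colour-joined j l v ≡c) (≡.sym same)

  module Tower (Y : Config) (q : Carrier) where

    -- All axes share one `q`, so a single parameter has to be generic; `p` adjusts the edge length
    -- of each axis.
    tower : ∀ {d} → (Fin d → Carrier) → Config
    tower {zero}  p = Y
    tower {suc d} p = shiftGraph (p 0F) q ⊗ tower (p ∘ Fin.suc)

    Ramsey-tower : ∀ {d n} (p b : Fin d → Carrier) (β : Fin d → Fin n → Bool) {D : Matrix n} →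
      (∀ k → (p k * p k + p k * p k) + 6 ×ℕ (q * q) ≈ b k) → Ramsey Y D →
      Ramsey (tower p) (λ i j → ∑[ k < d ] mismatch (β k i) (β k j) (b k) + D i j)
    Ramsey-tower {zero}  p b β {D} edge ramsey = Ramsey-resp {Y} (λ i j → sym (+-identityˡ (D i j))) ramsey
    Ramsey-tower {suc d} p b β {D} edge ramsey = Ramsey-resp {tower p} (λ i j → sym (+-assoc _ _ _))
      (Ramsey-shiftGraph {tower (p ∘ Fin.suc)} (β 0F) (edge 0F)
        (Ramsey-tower (p ∘ Fin.suc) (b ∘ Fin.suc) (β ∘ Fin.suc) {D} (edge ∘ Fin.suc) ramsey))

    -- Each axis costs a factor 4, by `separate`, and what it gains survives in the subfamilies
    -- taken for later axes. Repetitions in `w` are allowed because dropping an axis may identify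
    -- points.
    spread-subfamily : ∀ {d} (p : Fin d → Carrier) {n} (w : Fin n → Σ Point (_∈ tower p)) →
      ∃₂ λ m (φ : Fin m → Fin n) → Injective _≡_ _≡_ φ × n ℕ.≤ 4 ℕ.^ d ℕ.* m ×
        ∃ λ (y : Fin m → Σ Point (_∈ Y)) → ∀ a c → ∃ λ (μ : Fin d → Fin 3) →
          dist² (proj₁ (w (φ a))) (proj₁ (w (φ c)))
          ≈ μ · (λ k → (p k * p k + p k * p k) + (q * q + q * q)) + dist² (proj₁ (y a)) (proj₁ (y c))
    spread-subfamily {zero} p {n} w = n , id , id , ℕₚ.≤-reflexive (≡.sym (ℕₚ.*-identityˡ n)) , w ,
      λ a c → (λ ()) , sym (+-identityˡ _)
    spread-subfamily {suc d} p {n} w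
      with m , φ , φ-inj , n≤4m , i≢j ← separate (λ t → proj₁ (proj₁ (proj₂ (w t))))
             (λ t → proj₁ (proj₂ (proj₁ (proj₂ (w t))))) (λ t → proj₁ (proj₂ (proj₂ (proj₁ (proj₂ (w t))))))
      with m′ , ψ , ψ-inj , m≤4ᵈm′ , y , spread ← spread-subfamily (p ∘ Fin.suc)
             (λ a → odds (proj₁ (w (φ a))) , proj₂ (proj₂ (w (φ a))))
      = m′ , φ ∘ ψ , ψ-inj ∘ φ-inj ,
        ℕₚ.≤-trans n≤4m (ℕₚ.≤-trans (ℕₚ.*-monoʳ-≤ 4 m≤4ᵈm′) (ℕₚ.≤-reflexive (≡.sym (ℕₚ.*-assoc 4 (4 ℕ.^ d) m′)))) ,
        y , λ a c → extend (ψ a) (ψ c) (i≢j (ψ a) (ψ c)) (i≢j (ψ c) (ψ a)) (spread a c)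
      where
      extend : ∀ a c {rest} → proj₁ (proj₁ (proj₂ (w (φ a)))) ≢ proj₁ (proj₂ (proj₁ (proj₂ (w (φ c))))) →
        proj₁ (proj₁ (proj₂ (w (φ c)))) ≢ proj₁ (proj₂ (proj₁ (proj₂ (w (φ a))))) →
        (∃ λ (μ : Fin d → Fin 3) → dist² (odds (proj₁ (w (φ a)))) (odds (proj₁ (w (φ c))))
          ≈ μ · (λ k → (p (Fin.suc k) * p (Fin.suc k) + p (Fin.suc k) * p (Fin.suc k)) + (q * q + q * q)) + rest) →
        ∃ λ (μ : Fin (suc d) → Fin 3) → dist² (proj₁ (w (φ a))) (proj₁ (w (φ c)))
          ≈ μ · (λ k → (p k * p k + p k * p k) + (q * q + q * q)) + rest
      extend a c ia≢jc ic≢ja (μ , odds≈)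
        with za , (i , j , i<j , za≈) , _ ← w (φ a)
        with zc , (i′ , j′ , i′<j′ , zc≈) , _ ← w (φ c)
        with m₀ , evens≈ ← dist²-σ (p 0F) q i<j i′<j′ ia≢jc ic≢ja
        = μ′ , trans (dist²-split za zc)
            (trans (+-cong (trans (dist²-cong {evens za} {σ (p 0F) q i j} {evens zc} {σ (p 0F) q i′ j′} za≈ zc≈) evens≈) odds≈)
              (sym (+-assoc _ _ _)))
        where
        μ′ : Fin (suc d) → Fin 3
        μ′ 0F          = m₀
        μ′ (Fin.suc k) = μ k

  Bit : Carrier → Carrier → Set
  Bit a x = x ≈ 0# ⊎ x ≈ a

  bit : ∀ {a x} → Bit a x → Bool
  bit (inj₁ _) = false
  bit (inj₂ _) = true

  mismatch-bit : ∀ {a x y} (s : Bit a x) (t : Bit a y) → (x - y) * (x - y) ≈ mismatch (bit s) (bit t) (a * a)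
  mismatch-bit {a} (inj₁ x≈) (inj₁ y≈) =
    trans (*-cong eq eq) (solve 0 ((con (+ 0) :- con (+ 0)) :* (con (+ 0) :- con (+ 0)) := con (+ 0)) refl)
    where eq = +-cong x≈ (-‿cong y≈)
  mismatch-bit {a} (inj₁ x≈) (inj₂ y≈) =
    trans (*-cong eq eq) (solve 1 (λ a → (con (+ 0) :- a) :* (con (+ 0) :- a) := a :* a) refl a)
    where eq = +-cong x≈ (-‿cong y≈)
  mismatch-bit {a} (inj₂ x≈) (inj₁ y≈) =
    trans (*-cong eq eq) (solve 1 (λ a → (a :- con (+ 0)) :* (a :- con (+ 0)) := a :* a) refl a)
    where eq = +-cong x≈ (-‿cong y≈)
  mismatch-bit {a} (inj₂ x≈) (inj₂ y≈) =
    trans (*-cong eq eq) (solve 1 (λ a → (a :- a) :* (a :- a) := con (+ 0)) refl a)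
    where eq = +-cong x≈ (-‿cong y≈)

  dist²-box : ∀ {d a x y} (x∈ : x ∈ box d a) (y∈ : y ∈ box d a) →
    dist² x y ≈ ∑[ k < d ] mismatch (bit (proj₁ x∈ k)) (bit (proj₁ y∈ k)) (a k * a k)
  dist²-box {d} {a} {x} {y} (x-bits , x-rest) (y-bits , y-rest) = begin
    dist² x y                    ≈⟨ ‖‖²≈sumSq (x −ₚ y) (ℕₚ.m≤n⊔m d _) ⟩
    sumSq (d ℕ.⊔ bound (x −ₚ y)) (coord (x −ₚ y))
                                 ≈⟨ sumSq-extend (ℕₚ.m≤m⊔n d _) (λ n d≤n → trans (+-cong (x-rest n d≤n) (-‿cong (y-rest n d≤n))) (-‿inverseʳ 0#)) ⟨
    sumSq d (coord (x −ₚ y))     ≈⟨ sum-cong-≋ (λ k → mismatch-bit (x-bits k) (y-bits k)) ⟩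
    _                            ∎

-- Assembling the P-Ramsey witness for a brick product.

module BrickProducts (em : ExcludedMiddle (lsuc 0ℓ)) (ℝ : CompleteOrderedField) where

  open CompleteOrderedField ℝ hiding (zero)
  open Configurations ℝ
  open IntegerCoefficients ℝ
  open OrderedField em ℝ
  open SquareRoot em ℝ
  open Geometry em ℝ
  open Genericity em ℝ
  open Families em ℝ
  open import Algebra.Properties.CommutativeMonoid.Sum +-commutativeMonoid using (sum-syntax)
  open import Algebra.Properties.Monoid.Mult +-monoid using (×-congʳ) renaming (_×_ to _×ℕ_)
  open import Algebra.Properties.Semiring.Mult semiring using (×1-homo-*)
  open import Relation.Binary.Reasoning.Setoid setoid

  brick-splitting : ∀ {d} B Y F → IsBrick d B → ((n , h) : IsFinite F) → (B ⊗ Y) ContainsCopyOf F →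
    ∃ λ (a : Fin d → Carrier) → (∀ k → 0# < a k) ×
    ∃ λ (β : Fin d → Fin n → Bool) → ∃ λ (y : Fin n → Σ Point (_∈ Y)) →
      ∀ i j → ∑[ k < d ] mismatch (β k i) (β k j) (a k * a k) + dist² (proj₁ (y i)) (proj₁ (y j))
              ≈ distances F h i j
  brick-splitting {d} B Y F (a , 0<a , B≅box@(g , _)) (n , h) contains
    with z , dist-z ← contains⇒copy (B ⊗ Y) F h contains =
    a , 0<a , (λ k i → bit (proj₁ (proj₂ (b i)) k)) , y , λ i j → begin
      _ + dist² (proj₁ (y i)) (proj₁ (y j))
        ≈⟨ +-congʳ (dist²-box {d} {a} {proj₁ (b i)} {proj₁ (b j)} (proj₂ (b i)) (proj₂ (b j))) ⟨
      dist² (proj₁ (b i)) (proj₁ (b j)) + dist² (proj₁ (y i)) (proj₁ (y j))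
        ≈⟨ +-congʳ (≅⇒dist² {B} {box d a} B≅box (e i) (e j)) ⟩
      dist² (proj₁ (e i)) (proj₁ (e j)) + dist² (proj₁ (y i)) (proj₁ (y j))
        ≈⟨ dist²-split (proj₁ (z i)) (proj₁ (z j)) ⟨
      dist² (proj₁ (z i)) (proj₁ (z j))
        ≈⟨ dist-z i j ⟩
      distances F h i j ∎
    where
    e : Fin n → Σ Point (_∈ B)
    e i = evens (proj₁ (z i)) , proj₁ (proj₂ (z i))

    y : Fin n → Σ Point (_∈ Y)
    y i = odds (proj₁ (z i)) , proj₂ (proj₂ (z i))

    b : Fin n → Σ Point (_∈ box d a)
    b i = Bijection.to g (e i)

  half-root : ∀ {b s} → 6 ×ℕ s ≤ b → ∃ λ p → p * p + p * p + 6 ×ℕ s ≈ b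
  half-root {b} {s} 6s≤b = p , (begin
    p * p + p * p + 6 ×ℕ s              ≈⟨ +-congʳ (+-cong p²≈ p²≈) ⟩
    ½ * x + ½ * x + 6 ×ℕ s              ≈⟨ +-congʳ (½x+½x≈x x) ⟩
    b - 6 ×ℕ s + 6 ×ℕ s                 ≈⟨ solve 2 (λ b t → b :- t :+ t := b) refl b (6 ×ℕ s) ⟩
    b                                   ∎)
    where
    x : Carrier
    x = b - 6 ×ℕ s

    0≤½x : 0# ≤ ½ * x
    0≤½x = *-nonneg (proj₁ 0<½) (x≤y⇒0≤y-x 6s≤b)

    p : Carrier
    p = √ (½ * x) 0≤½x

    p²≈ : p * p ≈ ½ * x
    p²≈ = √-square (½ * x) 0≤½x

  0<n×1 : ∀ n → n ≥ 1 → 0# < n ×ℕ 1#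
  0<n×1 (suc n) _ = ×ℕ-pos n 0<1

  density-bound : ∀ {μ} K N m → 0# ≤ μ → (K ×ℕ 1#) * μ ≈ 1# → N ℕ.≤ K ℕ.* m → μ * (N ×ℕ 1#) ≤ m ×ℕ 1#
  density-bound {μ} K N m 0≤μ Kμ≈1 N≤Km = ≤-respʳ (begin
    μ * ((K ℕ.* m) ×ℕ 1#)            ≈⟨ *-congˡ (×1-homo-* K m) ⟩
    μ * ((K ×ℕ 1#) * (m ×ℕ 1#))      ≈⟨ solve 3 (λ u v x → u :* (v :* x) := (v :* u) :* x) refl μ (K ×ℕ 1#) (m ×ℕ 1#) ⟩
    ((K ×ℕ 1#) * μ) * (m ×ℕ 1#)      ≈⟨ *-congʳ Kμ≈1 ⟩
    1# * (m ×ℕ 1#)                   ≈⟨ *-identityˡ _ ⟩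
    m ×ℕ 1#                          ∎)
    (*-monoʳ-≤ 0≤μ (×ℕ-monoˡ-≤ 0≤1 N≤Km))

  module _ (Y F : Config) {n} (h : HasSize F n) (Y∌F : ¬ (Y ContainsCopyOf F))
           {d} (p : Fin d → Carrier) (q : Carrier)
           (avoids : ∀ i j (y y′ : Σ Point (_∈ Y)) ν →
              ν · (λ k → (p k * p k + p k * p k) + (q * q + q * q)) + dist² (proj₁ y) (proj₁ y′) ≈ distances F h i j →
              ν · (λ k → (p k * p k + p k * p k) + (q * q + q * q)) ≈ 0#) where

    open Tower Y q

    free-subset : ∀ W′ N → W′ ⊆ tower p → HasSize W′ N →
      ∃ λ Z → ∃ λ m → Z ⊆ W′ × HasSize Z m × Z IsFreeOf F × N ℕ.≤ 4 ℕ.^ d ℕ.* m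
    free-subset W′ N W′⊆W H =
      let m , φ , φ-inj , N≤4ᵈm , y , spread = spread-subfamily p
             (λ t → proj₁ (Bijection.to H t) , W′⊆W _ (proj₂ (Bijection.to H t)))
      in image (w φ) , m , image⊆ W′ (λ a → Bijection.to H (φ a))
       , hasSize (image (w φ)) (λ a → w φ a , a , ≈ₚ-refl {w φ a}) (φ-inj ∘ Bijection.injective H)
          (λ x (a , x≈wa) → a , ≈ₚ-sym {x} {w φ a} x≈wa)
       , free φ y spread , N≤4ᵈm
      where
      w : ∀ {m} → (Fin m → Fin N) → Fin m → Point
      w φ a = proj₁ (Bijection.to H (φ a))

      free : ∀ {m} (φ : Fin m → Fin N) (y : Fin m → Σ Point (_∈ Y)) →
        (∀ a c → ∃ λ (ν : Fin d → Fin 3) → dist² (w φ a) (w φ c)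
          ≈ ν · (λ k → (p k * p k + p k * p k) + (q * q + q * q)) + dist² (proj₁ (y a)) (proj₁ (y c))) →
        image (w φ) IsFreeOf F
      free φ y spread Z∋F = Y∌F (copy⇒contains Y F h (y ∘ α , dist-y))
        where
        copy = contains⇒copy (image (w φ)) F h Z∋F
        z = proj₁ copy
        α : Fin n → Fin _
        α i = proj₁ (proj₂ (z i))

        -- The axes contribute a sum that, with a distance of `Y`, makes up a distance of `F`;
        -- `avoids` forces that sum to vanish.
        dist-y : ∀ i j → dist² (proj₁ (y (α i))) (proj₁ (y (α j))) ≈ distances F h i j
        dist-y i j = trans (sym (+-identityˡ _))
          (trans (+-congʳ (sym (avoids i j (y (α i)) (y (α j)) (proj₁ (spread (α i) (α j))) total≈))) total≈)
          where
          total≈ : proj₁ (spread (α i) (α j)) · (λ k → (p k * p k + p k * p k) + (q * q + q * q))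
                     + dist² (proj₁ (y (α i))) (proj₁ (y (α j)))
                   ≈ distances F h i j
          total≈ = trans (sym (proj₂ (spread (α i) (α j))))
            (trans (sym (dist²-cong {proj₁ (z i)} {w φ (α i)} {proj₁ (z j)} {w φ (α j)}
              (proj₂ (proj₂ (z i))) (proj₂ (proj₂ (z j))))) (proj₂ copy i j))

  generic-edges : ∀ {Y n d} → IsCountable Y → (D : Matrix n) (b : Fin d → Carrier) → (∀ k → 0# < b k) →
    ∃₂ λ (p : Fin d → Carrier) q → (∀ k → (p k * p k + p k * p k) + 6 ×ℕ (q * q) ≈ b k) ×
      (∀ i j (y y′ : Σ Point (_∈ Y)) ν →
         ν · (λ k → (p k * p k + p k * p k) + (q * q + q * q)) + dist² (proj₁ y) (proj₁ y′) ≈ D i j →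
         ν · (λ k → (p k * p k + p k * p k) + (q * q + q * q)) ≈ 0#)
  generic-edges {Y} {n} {d} countable D b 0<b =
    let s , 0≤s , 6s≤b , avoids = generic {Y} countable D b 0<b
        root k = half-root (6s≤b k)
        q²≈s = √-square s 0≤s
        p : Fin d → Carrier
        p k = proj₁ (root k)
        -- `p k` itself depends on `s`; writing `2 p² + 2 q²` as `b k - 4 s` leaves `s` as the only
        -- unknown, as `generic` requires.
        spread≈ k = trans (+-congˡ (+-cong q²≈s q²≈s)) (six-minus-four _ _ s (proj₂ (root k)))
    in p , √ s 0≤s , (λ k → trans (+-congˡ (×-congʳ 6 q²≈s)) (proj₂ (root k)))
     , λ i j y y′ ν total≈ → trans (·-cong ν spread≈)
         (avoids i j y y′ ν (trans (+-congʳ (·-cong ν (λ k → sym (spread≈ k)))) total≈))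
    where
    six-minus-four : ∀ r b s → r + 6 ×ℕ s ≈ b → r + (s + s) ≈ b - 4 ×ℕ s
    six-minus-four r b s eq = trans
      (solve 2 (λ r s → r :+ (s :+ s) := (r :+ (s :+ (s :+ (s :+ (s :+ (s :+ (s :+ con (+ 0))))))))
                                         :- (s :+ (s :+ (s :+ (s :+ con (+ 0)))))) refl r s)
      (+-congʳ eq)

  brick-product-isPRamsey : ∀ d (B Y F : Config) → IsBrick d B → IsRobust Y → IsFinite F →
    (B ⊗ Y) ContainsCopyOf F → ¬ (Y ContainsCopyOf F) → IsPRamsey F
  brick-product-isPRamsey d B Y F brick robust (n , h) B⊗Y∋F Y∌F =
    let a , 0<a , β , y , splitting = brick-splitting {d} B Y F brick (n , h) B⊗Y∋F
        p , q , edge , avoids = generic-edges {Y} (proj₁ robust) (distances F h)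
                                  (λ k → a k * a k) (λ k → *-pos (0<a k) (0<a k))
        W = Tower.tower Y q p
        μ , 0<μ , 4ᵈμ≈1 = reciprocal {(4 ℕ.^ d) ×ℕ 1#} (0<n×1 (4 ℕ.^ d) (ℕₚ.m^n>0 4 d))
    in W , μ , 0<μ
     , Ramsey⇒⟶ W F h (Ramsey-resp {W} splitting
         (Tower.Ramsey-tower Y q p (λ k → a k * a k) β edge (robust⇒Ramsey Y robust y)))
     , λ W′ N W′⊆W H →
         let Z , m , Z⊆W′ , size , free , N≤4ᵈm = free-subset Y F h Y∌F p q avoids W′ N W′⊆W H
         in Z , m , Z⊆W′ , size , free , density-bound (4 ℕ.^ d) N m (proj₁ 0<μ) 4ᵈμ≈1 N≤4ᵈm

theorem3p4 : ExcludedMiddle (lsuc 0ℓ) → (ℝ : CompleteOrderedField) →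
    let open Configurations ℝ in
    (d : ℕ) → d ≥ 1 → (B Y F : Config) →
    IsBrick d B → IsRobust Y → IsFinite F →
    (B ⊗ Y) ContainsCopyOf F → ¬ (Y ContainsCopyOf F) →
    IsPRamsey F
theorem3p4 em ℝ d _ = BrickProducts.brick-product-isPRamsey em ℝ d
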